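{- There is an online algorithm that 2-colors the edges arriving in the first $1.06n$ rounds of the online random edge process on $n$ vertices such that, with high probability, every connected component in each of the two color classes has order $O(\log n)$.
   Context: Online random edge process: there are $n$ vertices and a sequence of rounds; in each round one edge arrives, chosen uniformly at random among all pairs of distinct vertices, independently of previous rounds (repetitions are possible). The algorithm must color each edge upon arrival, using only the history so far. "With high probability" means with probability tending to $1$ as $n\to\infty$. -}

module Defs where

open import Data.Nat using (ℕ; zero; suc; _+_; _*_; _≤ᵇ_)
open import Data.Nat.DivMod using (_/_)
open import Data.Nat.Logarithm using (⌊log₂_⌋)
open import Data.Bool using (Bool; true; false; if_then_else_; _∧_; _∨_; not)
open import Data.Fin using (Fin; _≟_)
import Data.Bool as Bool
open import Data.Fin.Subset using (Subset; ⁅_⁆; ∣_∣)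
open import Data.Vec using (Vec; tabulate; lookup)
open import Data.List using (List; []; _∷_; _++_; concatMap; map; allFin)
open import Data.Bool.ListAction using (any; all)
open import Data.Nat.ListAction using (sum)
open import Data.Product using (_×_; _,_)
open import Relation.Nullary.Decidable using (⌊_⌋)
open import Function using (const)

-- An edge arrival: an ordered pair of vertices (the sample space only
-- contains pairs with distinct endpoints, see edgesList).
Edge : ℕ → Set
Edge n = Fin n × Fin n

-- A (deterministic) online 2-colouring algorithm on n vertices:
-- given the history of previously arrived edges (oldest first) and the
-- newly arrived edge, it outputs the colour of the new edge.
OnlineAlg : ℕ → Set
OnlineAlg n = List (Edge n) → Edge n → Bool

runAlg : ∀ {n} → OnlineAlg n → List (Edge n) → List (Edge n × Bool)
runAlg {n} A es = go [] es
  where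
  go : List (Edge n) → List (Edge n) → List (Edge n × Bool)
  go hist [] = []
  go hist (e ∷ rest) = (e , A hist e) ∷ go (hist ++ (e ∷ [])) rest

classEdges : ∀ {n} → Bool → List (Edge n × Bool) → List (Edge n)
classEdges c [] = []
classEdges c ((e , b) ∷ rest) =
  if ⌊ b Bool.≟ c ⌋ then e ∷ classEdges c rest else classEdges c rest

closeStep : ∀ {n} → List (Edge n) → Subset n → Subset n
closeStep {n} es S = tabulate λ i →
  lookup S i ∨ any (λ { (u , v) →
      (⌊ u ≟ i ⌋ ∧ lookup S v) ∨ (⌊ v ≟ i ⌋ ∧ lookup S u) }) es

iterateN : ∀ {A : Set} → ℕ → (A → A) → A → A
iterateN zero f x = x
iterateN (suc k) f x = f (iterateN k f x)

-- The vertex set of the connected component containing v in the graph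
-- on Fin n with edge list es (n closure steps suffice).
component : ∀ {n} → List (Edge n) → Fin n → Subset n
component {n} es v = iterateN n (closeStep es) ⁅ v ⁆

componentOrder : ∀ {n} → List (Edge n) → Fin n → ℕ
componentOrder es v = ∣ component es v ∣

-- All arrivals: ordered pairs (u , v) of distinct vertices.  The uniform
-- distribution on these induces the uniform distribution on unordered pairs.
edgesList : ∀ n → List (Edge n)
edgesList n = concatMap (λ u → concatMap (λ v →
  if ⌊ u ≟ v ⌋ then [] else (u , v) ∷ []) (allFin n)) (allFin n)

countSeq : ∀ {n} → ℕ → (List (Edge n) → Bool) → ℕ
countSeq {n} zero P = if P [] then 1 else 0
countSeq {n} (suc m) P =
  sum (map (λ e → countSeq {n} m (λ es → P (e ∷ es))) (edgesList n))

rounds : ℕ → ℕ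
rounds n = (106 * n) / 100

good : ∀ {n} → ℕ → OnlineAlg n → List (Edge n) → Bool
good {n} C A es = all (λ c → all (λ v →
  componentOrder (classEdges c (runAlg A es)) v ≤ᵇ C * ⌊log₂ n ⌋)
  (allFin n)) (true ∷ false ∷ [])

badCount : (n : ℕ) → ℕ → OnlineAlg n → ℕ
badCount n C A = countSeq {n} (rounds n) (λ es → not (good C A es))

totalCount : ℕ → ℕ
totalCount n = countSeq {n} (rounds n) (const true)

-- The first ≈ n/2 edges are coloured red, which keeps the red graph subcritical.
-- Then ≈ 0.3678 n < n/e vertices still isolated in it are reserved; from there
-- on an edge is coloured red if both its ends are reserved and blue otherwise.
-- New red edges thus live on few vertices, away from the old ones, while the
-- blue graph is a two-type random graph that lacks the reserved–reserved edges;
-- its branching operator has norm < 1 for up to ≈ 0.5601 n further edges.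
--
-- That ≈ n/e vertices are isolated is a second moment estimate.  For the
-- component sizes, components are explored vertex by vertex.  A positive vector
-- contracted by the branching operator yields weights 1 + y w / Q such that the
-- expected product of the weights of the active vertices shrinks by a constant
-- factor per step, so reaching C log n steps has probability O(n⁻²).
-- Probabilities appear as counts of edge sequences and weights are multiplied
-- by Q, so that everything takes place in ℕ.

module Submission where

open import Defs
open import Data.Bool using (Bool; true; false; not; _∧_; _∨_; if_then_else_; T)
import Data.Bool as Bool
open import Data.Bool.ListAction using (all; any)
open import Data.Bool.Properties using (∧-comm)
open import Data.Empty using (⊥-elim)
open import Data.Fin using (Fin; zero; suc; _≟_)
open import Data.Fin.Subset using (Subset; ⁅_⁆; ∣_∣; _∪_) renaming (_∈_ to _∈ₛ_; ⊥ to ∅)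
open import Data.Fin.Subset.Properties
  using (x∈⁅y⁆⇒x≡y; p⊆q⇒∣p∣≤∣q∣; x∈⁅x⁆; x∈p∪q⁺; ∣⁅x⁆∣≡1; ∣⊥∣≡0; ∣p∣≤∣x∷p∣)
open import Data.List
  using (List; []; _∷_; [_]; _++_; map; length; filterᵇ; concatMap; foldr; allFin; take)
open import Data.List.Membership.Propositional using (_∈_)
open import Data.List.Membership.Propositional.Properties using (∈-++⁺ˡ; ∈-++⁺ʳ)
open import Data.List.Properties
  using (map-++; length-++; ++-assoc; ++-identityʳ; length-tabulate; map-tabulate)
open import Data.List.Relation.Unary.All using (All; []; _∷_)
import Data.List.Relation.Unary.All as All
open import Data.List.Relation.Unary.Any using (here; there)
open import Data.Nat
  using (ℕ; zero; suc; _+_; _*_; _∸_; _^_; _≤_; _<_; _≥_; _<ᵇ_; _≤ᵇ_; z≤n; s≤s; ⌊_/2⌋;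
         NonZero; >-nonZero; >-nonZero⁻¹)
open import Data.Nat.DivMod
open import Data.Nat.Induction using (<-rec)
open import Data.Nat.ListAction using (sum; product)
open import Data.Nat.ListAction.Properties using (sum-++; product-++)
open import Data.Nat.Logarithm
open import Data.Nat.Properties hiding (_≟_)
open import Data.Nat.Tactic.RingSolver using (solve-∀)
open import Data.Product using (Σ; _×_; _,_; proj₁; proj₂; ∃-syntax)
open import Data.Sum using (_⊎_; inj₁; inj₂)
open import Data.Unit using (tt)
open import Data.Vec using ([]; _∷_; lookup)
open import Data.Vec.Properties using (lookup∘tabulate; []=⇒lookup; lookup⇒[]=)
open import Function using (_∘_; id; const)
open import Relation.Binary.PropositionalEquality hiding ([_])
open import Relation.Nullary using (yes; no; contradiction)
open import Relation.Nullary.Decidable using (⌊_⌋)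

-- Sums and sums over words

-- With reserved fraction `ρ = 1/e` and `s n` late edges, put `c = 2s`; the blue branching operator
-- has spectral radius 1 when `c(1−ρ) + c²ρ(1−ρ) = 1`, that is at `s ≈ 0.56014`. So the strategy
-- stops working near `1.06014 n`, and 1.06 leaves a margin of order 10⁻⁴. This dictates the size of
-- the constants: the rounding in the phase lengths must fit into the margin, and the weights exceed
-- 1 by only about 10⁻⁶, so that linearising their powers costs less than the margin. The decay per
-- step is then tiny, and the constant in front of the logarithm huge.
--
-- The obstacle in an exploration is that inspecting a vertex conditions everything not yet seen.
-- Counting words avoids conditional probabilities: the revealed letters are deleted, and what is
-- left is an arbitrary word over a smaller alphabet. Its length depends on the word, so bounds are
-- proved for all large enough alphabets and all lengths up to `m` at once. A step deletes at most
-- `2n` of the `n(n−1)` letters, which is negligible over `C log n` steps.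

ι : Bool → ℕ
ι true  = 1
ι false = 0

ι≤1 : ∀ b → ι b ≤ 1
ι≤1 true  = s≤s z≤n
ι≤1 false = z≤n

ι-∧ : ∀ a b → ι (a ∧ b) ≡ ι a * ι b
ι-∧ true  b = sym (*-identityˡ _)
ι-∧ false b = refl

^-distribʳ-* : ∀ k a b → (a * b) ^ k ≡ a ^ k * b ^ k
^-distribʳ-* zero    a b = refl
^-distribʳ-* (suc k) a b = trans (cong (a * b *_) (^-distribʳ-* k a b))
  ([m*n]*[o*p]≡[m*o]*[n*p] a b (a ^ k) (b ^ k))

interchange : ∀ a b c d → (a + b) + (c + d) ≡ (a + c) + (b + d)
interchange = solve-∀

module _ {A : Set} where

  Σₗ : List A → (A → ℕ) → ℕ
  Σₗ xs f = sum (map f xs)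

  Σ-cong : ∀ xs {f g : A → ℕ} → (∀ x → f x ≡ g x) → Σₗ xs f ≡ Σₗ xs g
  Σ-cong []       eq = refl
  Σ-cong (x ∷ xs) eq = cong₂ _+_ (eq x) (Σ-cong xs eq)

  Σ-mono : ∀ xs {f g : A → ℕ} → (∀ x → f x ≤ g x) → Σₗ xs f ≤ Σₗ xs g
  Σ-mono []       le = z≤n
  Σ-mono (x ∷ xs) le = +-mono-≤ (le x) (Σ-mono xs le)

  Σ-+ : ∀ xs (f g : A → ℕ) → Σₗ xs (λ x → f x + g x) ≡ Σₗ xs f + Σₗ xs g
  Σ-+ []       f g = refl
  Σ-+ (x ∷ xs) f g =
    trans (cong (f x + g x +_) (Σ-+ xs f g)) (interchange (f x) (g x) _ _)

  Σ-*ˡ : ∀ xs c (f : A → ℕ) → Σₗ xs (λ x → c * f x) ≡ c * Σₗ xs f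
  Σ-*ˡ []       c f = sym (*-zeroʳ c)
  Σ-*ˡ (x ∷ xs) c f =
    trans (cong (c * f x +_) (Σ-*ˡ xs c f)) (sym (*-distribˡ-+ c (f x) _))

  Σ-*ʳ : ∀ xs (f : A → ℕ) c → Σₗ xs (λ x → f x * c) ≡ Σₗ xs f * c
  Σ-*ʳ xs f c = trans (Σ-cong xs λ x → *-comm (f x) c)
                      (trans (Σ-*ˡ xs c f) (*-comm c _))

  Σ-const : ∀ xs c → Σₗ xs (λ _ → c) ≡ length xs * c
  Σ-const []       c = refl
  Σ-const (x ∷ xs) c = cong (c +_) (Σ-const xs c)

  Σ-filter : ∀ (p : A → Bool) xs (f : A → ℕ) →
             Σₗ (filterᵇ p xs) f ≡ Σₗ xs (λ x → ι (p x) * f x)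
  Σ-filter p []       f = refl
  Σ-filter p (x ∷ xs) f with p x
  ... | true  = cong₂ _+_ (sym (*-identityˡ (f x))) (Σ-filter p xs f)
  ... | false = Σ-filter p xs f

  Σ-concatMap : ∀ {B : Set} (g : B → List A) ys (f : A → ℕ) →
                Σₗ (concatMap g ys) f ≡ sum (map (λ y → Σₗ (g y) f) ys)
  Σ-concatMap g []       f = refl
  Σ-concatMap g (y ∷ ys) f =
    trans (cong sum (map-++ f (g y) (concatMap g ys)))
    (trans (sum-++ (map f (g y)) _) (cong (Σₗ (g y) f +_) (Σ-concatMap g ys f)))

  length-filter-not : ∀ (p : A → Bool) xs →
    length (filterᵇ (not ∘ p) xs) + Σₗ xs (ι ∘ p) ≡ length xs
  length-filter-not p []       = refl
  length-filter-not p (x ∷ xs) with p x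
  ... | true  = trans (+-suc _ _) (cong suc (length-filter-not p xs))
  ... | false = cong suc (length-filter-not p xs)

  ι-not-all : ∀ (p : A → Bool) xs → ι (not (all p xs)) ≤ Σₗ xs (ι ∘ not ∘ p)
  ι-not-all p []       = z≤n
  ι-not-all p (x ∷ xs) with p x
  ... | true  = ι-not-all p xs
  ... | false = s≤s z≤n

Σ-swap : ∀ {A B : Set} (xs : List A) (ys : List B) (f : A → B → ℕ) →
         Σₗ xs (λ x → Σₗ ys (f x)) ≡ Σₗ ys (λ y → Σₗ xs (λ x → f x y))
Σ-swap []       ys f = sym (trans (Σ-const ys 0) (*-zeroʳ (length ys)))
Σ-swap (x ∷ xs) ys f =
  trans (cong (Σₗ ys (f x) +_) (Σ-swap xs ys f)) (sym (Σ-+ ys (f x) _))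

module _ {A : Set} (L : List A) where

  -- An unnormalised expectation: `length L ^ m` times the mean of `F` over a word of `m`
  -- independent uniform letters. The alphabet is a parameter because explorations shrink it.
  Seq : ℕ → (List A → ℕ) → ℕ
  Seq zero    F = F []
  Seq (suc m) F = Σₗ L (λ e → Seq m (λ es → F (e ∷ es)))

  Seq-mono : ∀ m {F G : List A → ℕ} →
             (∀ es → length es ≡ m → F es ≤ G es) → Seq m F ≤ Seq m G
  Seq-mono zero    le = le [] refl
  Seq-mono (suc m) le =
    Σ-mono L λ e → Seq-mono m λ es eq → le (e ∷ es) (cong suc eq)

  Seq-cong : ∀ m {F G : List A → ℕ} → (∀ es → F es ≡ G es) → Seq m F ≡ Seq m G
  Seq-cong zero    eq = eq []
  Seq-cong (suc m) eq = Σ-cong L λ e → Seq-cong m λ es → eq (e ∷ es)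

  Seq-+ : ∀ m (F G : List A → ℕ) → Seq m (λ es → F es + G es) ≡ Seq m F + Seq m G
  Seq-+ zero    F G = refl
  Seq-+ (suc m) F G = trans (Σ-cong L λ e → Seq-+ m _ _) (Σ-+ L _ _)

  Seq-*ˡ : ∀ m c (F : List A → ℕ) → Seq m (λ es → c * F es) ≡ c * Seq m F
  Seq-*ˡ zero    c F = refl
  Seq-*ˡ (suc m) c F = trans (Σ-cong L λ e → Seq-*ˡ m c _) (Σ-*ˡ L c _)

  Seq-*ʳ : ∀ m (F : List A → ℕ) c → Seq m (λ es → F es * c) ≡ Seq m F * c
  Seq-*ʳ zero    F c = refl
  Seq-*ʳ (suc m) F c = trans (Σ-cong L λ e → Seq-*ʳ m _ c) (Σ-*ʳ L _ c)

  Seq-const : ∀ m c → Seq m (λ _ → c) ≡ length L ^ m * c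
  Seq-const zero    c = sym (*-identityˡ c)
  Seq-const (suc m) c = trans (Σ-cong L λ e → Seq-const m c)
    (trans (Σ-const L _) (sym (*-assoc (length L) (length L ^ m) c)))

  Seq-Σ : ∀ {B : Set} m (ys : List B) (F : B → List A → ℕ) →
          Seq m (λ es → Σₗ ys (λ y → F y es)) ≡ Σₗ ys (λ y → Seq m (F y))
  Seq-Σ zero    ys F = refl
  Seq-Σ (suc m) ys F = trans (Σ-cong L λ e → Seq-Σ m ys _) (Σ-swap L ys _)

  Seq-split : ∀ m₁ m₂ (F : List A → ℕ) →
    Seq (m₁ + m₂) F ≡ Seq m₁ (λ es₁ → Seq m₂ (λ es₂ → F (es₁ ++ es₂)))
  Seq-split zero     m₂ F = refl
  Seq-split (suc m₁) m₂ F = Σ-cong L λ e → Seq-split m₁ m₂ _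

  -- Letters are independent, so a condition imposed on every letter factorises.
  Seq-all : ∀ m (p : A → Bool) → Seq m (ι ∘ all p) ≡ Σₗ L (ι ∘ p) ^ m
  Seq-all zero    p = refl
  Seq-all (suc m) p = trans (Σ-cong L λ e →
      trans (Seq-cong m λ es → ι-∧ (p e) (all p es))
      (trans (Seq-*ˡ m (ι (p e)) _) (cong (ι (p e) *_) (Seq-all m p))))
    (Σ-*ʳ L (ι ∘ p) _)

countSeq≡Seq : ∀ {n} m (P : List (Edge n) → Bool) →
               countSeq m P ≡ Seq (edgesList n) m (ι ∘ P)
countSeq≡Seq zero P with P []
... | true  = refl
... | false = refl
countSeq≡Seq {n} (suc m) P = Σ-cong (edgesList n) λ e → countSeq≡Seq m _

-- Reveals which letters of a word satisfy t: these contribute their label's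
-- weight α / Q, and the remaining ones form a word over the smaller alphabet R.
module _ {A B : Set} (L : List A) (t : A → Bool) (o : A → B) (α : B → ℕ) (Q : ℕ) where

  private
    R : List A
    R = filterᵇ (not ∘ t) L

    r : ℕ
    r = length R

    S : ℕ
    S = Q * r + Σₗ L (λ e → ι (t e) * α (o e))

    weight : List B → ℕ
    weight N = product (map α N)

    reveal : (List B → List A → ℕ) → List A → ℕ
    reveal f es = f (map o (filterᵇ t es)) (filterᵇ (not ∘ t) es)

    reveal-∷ : ∀ m f e → Seq L m (λ es → reveal f (e ∷ es)) ≡
      ι (t e) * Seq L m (reveal (λ N → f (o e ∷ N))) +
      ι (not (t e)) * Seq L m (reveal (λ N es → f N (e ∷ es)))
    reveal-∷ m f e with t e
    ... | true  = sym (trans (+-identityʳ _) (*-identityˡ _))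
    ... | false = sym (*-identityˡ _)

    shuffle₁ : ∀ s q z → s * (q * z) ≡ s * q * z
    shuffle₁ = solve-∀
    shuffle₂ : ∀ p c a z → p * (c * (a * z)) ≡ p * (c * a * z)
    shuffle₂ = solve-∀
    shuffle₃ : ∀ p r c z → r * p * (c * z) ≡ p * (r * c * z)
    shuffle₃ = solve-∀
    shuffle₄ : ∀ u v q z → (u + v) * (q * z) ≡ u * (q * z) + q * (v * z)
    shuffle₄ = solve-∀
    shuffle₅ : ∀ x q r c s → x * (c * s) + q * (r * c * s) ≡ c * ((q * r + x) * s)
    shuffle₅ = solve-∀
    shuffle₆ : ∀ c a s → c * a * s ≡ a * (c * s)
    shuffle₆ = solve-∀

  open ≤-Reasoning

  -- Induction on the first letter. A revealed letter moves its label into `f` and its weight `α`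
  -- into `c`; an unrevealed one is summed over `R` inside `f`, which turns `c` into `r * c`. Hence
  -- `f` and `c` must vary, and the two cases add up to one factor `S`. How many letters stay
  -- unrevealed depends on the word, whence the hypothesis for all `k ≤ m`.
  reveal-bound : ∀ m f c →
    (∀ N k → k ≤ m → Seq R k (f N) * Q ^ length N ≤ r ^ k * (c * weight N)) →
    Seq L m (reveal f) * Q ^ m ≤ c * S ^ m
  reveal-bound zero f c hyp = begin
    f [] [] * 1       ≤⟨ hyp [] 0 z≤n ⟩
    1 * (c * 1)       ≡⟨ *-identityˡ _ ⟩
    c * 1             ∎
  reveal-bound (suc m) f c hyp = begin
    Seq L (suc m) (reveal f) * Q ^ suc m
      ≡⟨ cong (_* Q ^ suc m) (trans (Σ-cong L (reveal-∷ m f)) (Σ-+ L _ _)) ⟩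
    (Σₗ L (λ e → ι (t e) * X e) + Σₗ L (λ e → ι (not (t e)) * Y e)) * Q ^ suc m
      ≡⟨ cong (λ y → (Σₗ L (λ e → ι (t e) * X e) + y) * Q ^ suc m) ΣY ⟩
    (Σₗ L (λ e → ι (t e) * X e) + Seq L m (reveal f″)) * (Q * Q ^ m)
      ≡⟨ shuffle₄ (Σₗ L (λ e → ι (t e) * X e)) _ Q (Q ^ m) ⟩
    Σₗ L (λ e → ι (t e) * X e) * (Q * Q ^ m) + Q * (Seq L m (reveal f″) * Q ^ m)
      ≤⟨ +-mono-≤ touched (*-monoʳ-≤ Q (reveal-bound m f″ (r * c) hyp″)) ⟩
    Σₗ L (λ e → ι (t e) * α (o e)) * (c * S ^ m) + Q * (r * c * S ^ m)
      ≡⟨ shuffle₅ _ Q r c (S ^ m) ⟩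
    c * S ^ suc m ∎
    where
    X Y : A → ℕ
    X e = Seq L m (reveal (λ N → f (o e ∷ N)))
    Y e = Seq L m (reveal (λ N es → f N (e ∷ es)))

    f′ : A → List B → List A → ℕ
    f′ e N es = f (o e ∷ N) es * Q

    f″ : List B → List A → ℕ
    f″ N es = Σₗ R (λ e → f N (e ∷ es))

    ΣY : Σₗ L (λ e → ι (not (t e)) * Y e) ≡ Seq L m (reveal f″)
    ΣY = trans (sym (Σ-filter (not ∘ t) L Y)) (sym (Seq-Σ L m R _))

    hyp′ : ∀ e N k → k ≤ m →
      Seq R k (f′ e N) * Q ^ length N ≤ r ^ k * (c * α (o e) * weight N)
    hyp′ e N k k≤m = begin
      Seq R k (f′ e N) * Q ^ length N
        ≡⟨ cong (_* Q ^ length N) (Seq-*ʳ R k (f (o e ∷ N)) Q) ⟩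
      Seq R k (f (o e ∷ N)) * Q * Q ^ length N
        ≡⟨ shuffle₁ (Seq R k (f (o e ∷ N))) Q (Q ^ length N) ⟨
      Seq R k (f (o e ∷ N)) * Q ^ suc (length N)
        ≤⟨ hyp (o e ∷ N) k (m≤n⇒m≤1+n k≤m) ⟩
      r ^ k * (c * (α (o e) * weight N))
        ≡⟨ shuffle₂ (r ^ k) c _ _ ⟩
      r ^ k * (c * α (o e) * weight N) ∎

    hyp″ : ∀ N k → k ≤ m →
      Seq R k (f″ N) * Q ^ length N ≤ r ^ k * (r * c * weight N)
    hyp″ N k k≤m = begin
      Seq R k (f″ N) * Q ^ length N
        ≡⟨ cong (_* Q ^ length N) (Seq-Σ R k R _) ⟩
      Seq R (suc k) (f N) * Q ^ length N
        ≤⟨ hyp N (suc k) (s≤s k≤m) ⟩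
      r ^ suc k * (c * weight N)
        ≡⟨ shuffle₃ (r ^ k) r c _ ⟩
      r ^ k * (r * c * weight N) ∎

    touched : Σₗ L (λ e → ι (t e) * X e) * (Q * Q ^ m) ≤
              Σₗ L (λ e → ι (t e) * α (o e)) * (c * S ^ m)
    touched = begin
      Σₗ L (λ e → ι (t e) * X e) * (Q * Q ^ m)
        ≡⟨ Σ-*ʳ L _ (Q * Q ^ m) ⟨
      Σₗ L (λ e → ι (t e) * X e * (Q * Q ^ m))
        ≤⟨ Σ-mono L one ⟩
      Σₗ L (λ e → ι (t e) * α (o e) * (c * S ^ m))
        ≡⟨ Σ-*ʳ L _ (c * S ^ m) ⟩
      Σₗ L (λ e → ι (t e) * α (o e)) * (c * S ^ m) ∎
      where
      one : ∀ e → ι (t e) * X e * (Q * Q ^ m) ≤ ι (t e) * α (o e) * (c * S ^ m)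
      one e = begin
        ι (t e) * X e * (Q * Q ^ m)
          ≡⟨ *-assoc (ι (t e)) (X e) _ ⟩
        ι (t e) * (X e * (Q * Q ^ m))
          ≡⟨ cong (ι (t e) *_) (shuffle₁ (X e) Q (Q ^ m)) ⟩
        ι (t e) * (X e * Q * Q ^ m)
          ≡⟨ cong (λ x → ι (t e) * (x * Q ^ m)) (Seq-*ʳ L m _ Q) ⟨
        ι (t e) * (Seq L m (reveal (f′ e)) * Q ^ m)
          ≤⟨ *-monoʳ-≤ (ι (t e)) (reveal-bound m (f′ e) (c * α (o e)) (hyp′ e)) ⟩
        ι (t e) * (c * α (o e) * S ^ m)
          ≡⟨ cong (ι (t e) *_) (shuffle₆ c _ _) ⟩
        ι (t e) * (α (o e) * (c * S ^ m))
          ≡⟨ *-assoc (ι (t e)) (α (o e)) _ ⟨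
        ι (t e) * α (o e) * (c * S ^ m) ∎

-- Exploring components

module Exploration {n : ℕ} (r : Edge n → Bool) where

  touches : Fin n → Edge n → Bool
  touches w (u , v) = r (u , v) ∧ (⌊ u ≟ w ⌋ ∨ ⌊ v ≟ w ⌋)

  otherEnd : Fin n → Edge n → Fin n
  otherEnd w (u , v) = if ⌊ u ≟ w ⌋ then v else u

  -- Exploring from the active vertices W along edges satisfying r still has
  -- an active vertex after j vertices have been processed.
  survives : ℕ → List (Fin n) → List (Edge n) → Bool
  survives j       []      es = false
  survives zero    (w ∷ W) es = true
  survives (suc j) (w ∷ W) es =
    survives j (map (otherEnd w) (filterᵇ (touches w) es) ++ W)
               (filterᵇ (not ∘ touches w) es)

  Closed : List (Fin n) → Edge n → Set
  Closed S (u , v) = r (u , v) ≡ true → (u ∈ S → v ∈ S) × (v ∈ S → u ∈ S)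

  otherEnd-fst : ∀ w v → otherEnd w (w , v) ≡ v
  otherEnd-fst w v with w ≟ w
  ... | yes _  = refl
  ... | no w≢w = contradiction refl w≢w

  otherEnd-snd : ∀ {w u} v → u ≢ w → otherEnd w (u , v) ≡ u
  otherEnd-snd {w} {u} v u≢w with u ≟ w
  ... | yes u≡w = contradiction u≡w u≢w
  ... | no _    = refl

  -- Edges discovered at `w` have both ends in `w ∷ S`; all other edges satisfying `r` miss `w`, so
  -- adding it to `S` does not affect them.
  closed-step : ∀ w S es →
    (∀ {x} → x ∈ map (otherEnd w) (filterᵇ (touches w) es) → x ∈ S) →
    All (Closed S) (filterᵇ (not ∘ touches w) es) → All (Closed (w ∷ S)) es
  closed-step w S [] nb rest = []
  closed-step w S ((u , v) ∷ es) nb rest with r (u , v) in req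
  closed-step w S ((u , v) ∷ es) nb (_ ∷ rest) | false =
    (λ q → contradiction (trans (sym req) q) λ ()) ∷ closed-step w S es nb rest
  closed-step w S ((u , v) ∷ es) nb rest | true with u ≟ w | v ≟ w
  closed-step w S ((.w , v) ∷ es) nb rest | true | yes refl | _ =
    (λ _ → (λ _ → there (nb (here (sym (otherEnd-fst w v))))) , (λ _ → here refl))
    ∷ closed-step w S es (nb ∘ there) rest
  closed-step w S ((u , .w) ∷ es) nb rest | true | no u≢w | yes refl =
    (λ _ → (λ _ → here refl) , (λ _ → there (nb (here (sym (otherEnd-snd w u≢w))))))
    ∷ closed-step w S es (nb ∘ there) rest
  closed-step w S ((u , v) ∷ es) nb (c ∷ rest) | true | no u≢w | no v≢w =
    (λ q → widen u≢w (proj₁ (c q)) , widen v≢w (proj₂ (c q)))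
    ∷ closed-step w S es nb rest
    where
    widen : ∀ {a b} → a ≢ w → (a ∈ S → b ∈ S) → a ∈ w ∷ S → b ∈ w ∷ S
    widen a≢w g (here eq)  = contradiction eq a≢w
    widen a≢w g (there a∈) = there (g a∈)

  -- The witness `S` lists the processed vertices. At extinction every active vertex has been
  -- processed, and an edge was removed only when one end was processed and the other became active.
  -- Extinction is tested before the step counter, so the bound is `j` itself.
  extinct⇒closed : ∀ j W es → survives j W es ≡ false →
    ∃[ S ] length S ≤ j × (∀ {x} → x ∈ W → x ∈ S) × All (Closed S) es
  extinct⇒closed j [] es eq =
    [] , z≤n , (λ ()) , All.universal (λ _ _ → (λ ()) , (λ ())) es
  extinct⇒closed (suc j) (w ∷ W) es eq
    with S , len , W⊆S , cl ← extinct⇒closed j _ _ eq =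
    w ∷ S , s≤s len , W⊆ ,
    closed-step w S es (λ x∈ → W⊆S (∈-++⁺ˡ x∈)) cl
    where
    W⊆ : ∀ {x} → x ∈ w ∷ W → x ∈ w ∷ S
    W⊆ (here eq)  = here eq
    W⊆ (there x∈) = there (W⊆S (∈-++⁺ʳ (map (otherEnd w) (filterᵇ (touches w) es)) x∈))

  -- A supersolution of the branching recursion: cond says that replacing an
  -- active w by its random neighbours shrinks the expected weight by Q / (Q + h).
  module Subcritical
    (Q h : ℕ) .{{_ : NonZero Q}} (y Y : Fin n → ℕ) (t₀ M₀ m : ℕ)
    (cond : ∀ w b k → M₀ ≤ b → k ≤ m →
      (Q + h) * (Q * b + Y w) ^ k ≤ (Q + y w) * (Q * b) ^ k)
    where

    private
      α : Fin n → ℕ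
      α w = Q + y w

      ∏ : List (Fin n) → ℕ
      ∏ W = product (map α W)

      Q^≤∏ : ∀ W → Q ^ length W ≤ ∏ W
      Q^≤∏ []      = ≤-refl
      Q^≤∏ (w ∷ W) = *-mono-≤ (m≤m+n Q (y w)) (Q^≤∏ W)

      split-α : ∀ L (w : Fin n) →
        Σₗ L (λ e → ι (touches w e) * α (otherEnd w e)) ≡
        Q * Σₗ L (ι ∘ touches w) + Σₗ L (λ e → ι (touches w e) * y (otherEnd w e))
      split-α L w = trans
        (Σ-cong L λ e → trans (*-distribˡ-+ (ι (touches w e)) Q _)
                              (cong (_+ ι (touches w e) * y (otherEnd w e)) (*-comm _ Q)))
        (trans (Σ-+ L _ _) (cong (_+ _) (Σ-*ˡ L Q _)))

      Σ-filter-≤ : ∀ (p : Edge n → Bool) L (f : Edge n → ℕ) →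
        Σₗ (filterᵇ p L) f ≤ Σₗ L f
      Σ-filter-≤ p L f = ≤-trans (≤-reflexive (Σ-filter p L f))
        (Σ-mono L λ e → ≤-trans (*-monoˡ-≤ (f e) (ι≤1 (p e))) (≤-reflexive (*-identityˡ _)))

      ring₁ : ∀ s a b c → s * (a * b) * c ≡ s * (a * (c * b))
      ring₁ = solve-∀
      ring₂ : ∀ l q u v → l * (q * (u * v)) ≡ l * (q * v * u)
      ring₂ = solve-∀
      ring₃ : ∀ s g gj q qw qk → s * ((g * gj) * (q * qw)) * qk ≡ s * (gj * qw) * qk * (g * q)
      ring₃ = solve-∀
      ring₄ : ∀ c s g q → c * s * (g * q) ≡ c * q * (g * s)
      ring₄ = solve-∀
      ring₅ : ∀ qj p q a qk l → qj * p * q * (a * (qk * l)) ≡ l * (q * qj * (a * p)) * qk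
      ring₅ = solve-∀

    open ≤-Reasoning

    -- Markov's inequality for the product of the weights of the active vertices: it is at least 1
    -- while some vertex is active, and `cond` shrinks its mean by `Q / (Q + h)` per step. The
    -- alphabet and the word length vary in the induction, since revealed letters leave both. Each
    -- step removes at most `t₀` letters, so at least `M₀` are present whenever `cond` is applied.
    survives-bound : ∀ j W L → M₀ + j * t₀ ≤ length L →
      (∀ w → Σₗ L (λ e → ι (touches w e) * y (otherEnd w e)) ≤ Y w) →
      (∀ w → Σₗ L (ι ∘ touches w) ≤ t₀) → ∀ k → k ≤ m →
      Seq L k (ι ∘ survives j W) * ((Q + h) ^ j * Q ^ length W) ≤
      length L ^ k * (Q ^ j * ∏ W)
    survives-bound j [] L _ _ _ k _ = begin
      Seq L k (λ _ → 0) * _ ≡⟨ cong (_* ((Q + h) ^ j * 1)) (trans (Seq-const L k 0) (*-zeroʳ (length L ^ k))) ⟩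
      0                     ≤⟨ z≤n ⟩
      _ ∎
    survives-bound zero (w ∷ W) L _ _ _ k _ = begin
      Seq L k (λ _ → 1) * (1 * Q ^ suc (length W))
        ≡⟨ cong (_* (1 * Q ^ suc (length W))) (trans (Seq-const L k 1) (*-identityʳ (length L ^ k))) ⟩
      length L ^ k * (1 * Q ^ suc (length W))
        ≤⟨ *-monoʳ-≤ (length L ^ k) (*-monoʳ-≤ 1 (Q^≤∏ (w ∷ W))) ⟩
      length L ^ k * (1 * ∏ (w ∷ W)) ∎
    survives-bound (suc j) (w ∷ W) L big sumY sumT k k≤m =
      *-cancelʳ-≤ _ _ (Q ^ k) {{m^n≢0 Q k}} (begin
      Φ * ((Q + h) ^ suc j * Q ^ suc (length W)) * Q ^ k
        ≡⟨ ring₃ Φ (Q + h) _ Q _ _ ⟩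
      Φ * P * Q ^ k * ((Q + h) * Q)
        ≡⟨ cong (λ x → x * Q ^ k * ((Q + h) * Q)) (Seq-*ʳ L k _ P) ⟨
      Seq L k (λ es → ι (survives (suc j) (w ∷ W) es) * P) * Q ^ k * ((Q + h) * Q)
        -- The labels revealed at `w` are its new neighbours; `hyp` is the induction hypothesis for
        -- the exploration continued from them.
        ≤⟨ *-monoˡ-≤ ((Q + h) * Q)
             (reveal-bound L (touches w) (otherEnd w) α Q k f c hyp) ⟩
      c * (Q * length R + Σₗ L (λ e → ι (touches w e) * α (otherEnd w e))) ^ k * ((Q + h) * Q)
        ≡⟨ ring₄ c _ (Q + h) Q ⟩
      c * Q * ((Q + h) * (Q * length R + Σₗ L (λ e → ι (touches w e) * α (otherEnd w e))) ^ k)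
        ≤⟨ *-monoʳ-≤ (c * Q) (*-monoʳ-≤ (Q + h) (^-monoˡ-≤ k S≤)) ⟩
      c * Q * ((Q + h) * (Q * length L + Y w) ^ k)
        ≤⟨ *-monoʳ-≤ (c * Q) (cond w (length L) k (m+n≤o⇒m≤o M₀ big) k≤m) ⟩
      c * Q * (α w * (Q * length L) ^ k)
        ≡⟨ cong (λ x → c * Q * (α w * x)) (^-distribʳ-* k Q (length L)) ⟩
      c * Q * (α w * (Q ^ k * length L ^ k))
        ≡⟨ ring₅ (Q ^ j) (∏ W) Q (α w) (Q ^ k) (length L ^ k) ⟩
      length L ^ k * (Q ^ suc j * ∏ (w ∷ W)) * Q ^ k ∎)
      where
      R = filterᵇ (not ∘ touches w) L
      P = (Q + h) ^ j * Q ^ length W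
      c = Q ^ j * ∏ W
      Φ = Seq L k (ι ∘ survives (suc j) (w ∷ W))

      f : List (Fin n) → List (Edge n) → ℕ
      f N es = ι (survives j (N ++ W) es) * P


      -- Revealed and unrevealed letters together make up `L`, so their common factor `Q` yields
      -- `Q * length L`, and only the excess weights `y` of the neighbours remain.
      S≤ : Q * length R + Σₗ L (λ e → ι (touches w e) * α (otherEnd w e)) ≤ Q * length L + Y w
      S≤ = begin
        Q * length R + Σₗ L (λ e → ι (touches w e) * α (otherEnd w e))
          ≡⟨ cong (Q * length R +_) (split-α L w) ⟩
        Q * length R + (Q * Σₗ L (ι ∘ touches w) + Σₗ L (λ e → ι (touches w e) * y (otherEnd w e)))
          ≡⟨ +-assoc (Q * length R) _ _ ⟨
        Q * length R + Q * Σₗ L (ι ∘ touches w) + Σₗ L (λ e → ι (touches w e) * y (otherEnd w e))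
          ≡⟨ cong (_+ Σₗ L (λ e → ι (touches w e) * y (otherEnd w e)))
               (trans (sym (*-distribˡ-+ Q _ _)) (cong (Q *_) (length-filter-not (touches w) L))) ⟩
        Q * length L + Σₗ L (λ e → ι (touches w e) * y (otherEnd w e))
          ≤⟨ +-monoʳ-≤ (Q * length L) (sumY w) ⟩
        Q * length L + Y w ∎

      bigR : M₀ + j * t₀ ≤ length R
      bigR = +-cancelʳ-≤ t₀ _ _ (begin
        M₀ + j * t₀ + t₀   ≡⟨ trans (+-assoc M₀ _ t₀) (cong (M₀ +_) (+-comm _ t₀)) ⟩
        M₀ + suc j * t₀    ≤⟨ big ⟩
        length L           ≡⟨ length-filter-not (touches w) L ⟨
        length R + Σₗ L (ι ∘ touches w) ≤⟨ +-monoʳ-≤ (length R) (sumT w) ⟩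
        length R + t₀ ∎)

      hyp : ∀ N i → i ≤ k →
        Seq R i (f N) * Q ^ length N ≤ length R ^ i * (c * ∏ N)
      hyp N i i≤k = begin
        Seq R i (f N) * Q ^ length N
          ≡⟨ cong (_* Q ^ length N) (Seq-*ʳ R i _ P) ⟩
        Φ′ * P * Q ^ length N
          ≡⟨ ring₁ Φ′ ((Q + h) ^ j) (Q ^ length W) (Q ^ length N) ⟩
        Φ′ * ((Q + h) ^ j * (Q ^ length N * Q ^ length W))
          ≡⟨ cong (λ x → Φ′ * ((Q + h) ^ j * x))
               (trans (sym (^-distribˡ-+-* Q (length N) (length W)))
                      (cong (Q ^_) (sym (length-++ N)))) ⟩
        Φ′ * ((Q + h) ^ j * Q ^ length (N ++ W))
          ≤⟨ survives-bound j (N ++ W) R bigR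
               (λ v → ≤-trans (Σ-filter-≤ _ L _) (sumY v))
               (λ v → ≤-trans (Σ-filter-≤ _ L _) (sumT v)) i (≤-trans i≤k k≤m) ⟩
        length R ^ i * (Q ^ j * ∏ (N ++ W))
          ≡⟨ cong (λ x → length R ^ i * (Q ^ j * x))
               (trans (cong product (map-++ α N W)) (product-++ (map α N) (map α W))) ⟩
        length R ^ i * (Q ^ j * (∏ N * ∏ W))
          ≡⟨ ring₂ (length R ^ i) (Q ^ j) (∏ N) (∏ W) ⟩
        length R ^ i * (c * ∏ N) ∎
        where
        Φ′ = Seq R i (λ es → ι (survives j (N ++ W) es))

-- Bounding components by stable predicates

module _ {n : ℕ} where

  Stable : (Fin n → Set) → Edge n → Set
  Stable P (u , v) = (P u → P v) × (P v → P u)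

  private
    any-true : ∀ (f : Edge n → Bool) es → any f es ≡ true → ∃[ e ] e ∈ es × f e ≡ true
    any-true f (e ∷ es) eq with f e in fe
    ... | true  = e , here refl , fe
    ... | false with e′ , e′∈ , fe′ ← any-true f es eq = e′ , there e′∈ , fe′

    ∨-split : ∀ a {b} → a ∨ b ≡ true → a ≡ true ⊎ b ≡ true
    ∨-split true  eq = inj₁ refl
    ∨-split false eq = inj₂ eq

    ≟∧-split : ∀ (u i : Fin n) {b} → ⌊ u ≟ i ⌋ ∧ b ≡ true → u ≡ i × b ≡ true
    ≟∧-split u i eq with u ≟ i
    ≟∧-split u i eq | yes p = p , eq

  module _ (P : Fin n → Set) (es : List (Edge n)) (stable : All (Stable P) es) where

    closeStep-⊆ : ∀ S → (∀ i → lookup S i ≡ true → P i) →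
                  ∀ i → lookup (closeStep es S) i ≡ true → P i
    closeStep-⊆ S S⊆ i eq with ∨-split _ (trans (sym (lookup∘tabulate _ i)) eq)
    ... | inj₁ i∈S = S⊆ i i∈S
    ... | inj₂ eq′ with any-true _ es eq′
    ... | (u , v) , e∈ , fe with ∨-split (⌊ u ≟ i ⌋ ∧ lookup S v) fe
    ... | inj₁ p with refl , v∈S ← ≟∧-split u i p = proj₂ (All.lookup stable e∈) (S⊆ v v∈S)
    ... | inj₂ p with refl , u∈S ← ≟∧-split v i p = proj₁ (All.lookup stable e∈) (S⊆ u u∈S)

    iterate-⊆ : ∀ k S → (∀ i → lookup S i ≡ true → P i) →
                ∀ i → lookup (iterateN k (closeStep es) S) i ≡ true → P i
    iterate-⊆ zero    S S⊆ = S⊆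
    iterate-⊆ (suc k) S S⊆ = closeStep-⊆ (iterateN k (closeStep es) S) (iterate-⊆ k S S⊆)

    component-⊆ : ∀ v → P v → ∀ i → i ∈ₛ component es v → P i
    component-⊆ v Pv i i∈ = iterate-⊆ n ⁅ v ⁆
      (λ j eq → subst P (sym (x∈⁅y⁆⇒x≡y v (lookup⇒[]= j ⁅ v ⁆ eq))) Pv) i ([]=⇒lookup i∈)

  private
    fromList : List (Fin n) → Subset n
    fromList = foldr (λ x S → ⁅ x ⁆ ∪ S) ∅

    ∈-fromList : ∀ {i} S → i ∈ S → i ∈ₛ fromList S
    ∈-fromList (x ∷ S) (here refl) = x∈p∪q⁺ (inj₁ (x∈⁅x⁆ x))
    ∈-fromList (x ∷ S) (there i∈)  = x∈p∪q⁺ {p = ⁅ x ⁆} (inj₂ (∈-fromList S i∈))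

    ∣∪∣≤ : ∀ {k} (p q : Subset k) → ∣ p ∪ q ∣ ≤ ∣ p ∣ + ∣ q ∣
    ∣∪∣≤ []          []          = z≤n
    ∣∪∣≤ (true ∷ p)  (b ∷ q)     =
      s≤s (≤-trans (∣∪∣≤ p q) (+-monoʳ-≤ ∣ p ∣ (∣p∣≤∣x∷p∣ b q)))
    ∣∪∣≤ (false ∷ p) (true ∷ q)  =
      ≤-trans (s≤s (∣∪∣≤ p q)) (≤-reflexive (sym (+-suc ∣ p ∣ ∣ q ∣)))
    ∣∪∣≤ (false ∷ p) (false ∷ q) = ∣∪∣≤ p q

    ∣fromList∣≤ : ∀ S → ∣ fromList S ∣ ≤ length S
    ∣fromList∣≤ []      = ≤-reflexive (∣⊥∣≡0 n)
    ∣fromList∣≤ (x ∷ S) = ≤-trans (∣∪∣≤ ⁅ x ⁆ (fromList S))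
      (+-mono-≤ (≤-reflexive (∣⁅x⁆∣≡1 x)) (∣fromList∣≤ S))

  -- A stable predicate that holds at `v` is preserved by every closure step. It is kept apart from
  -- the list `S` because a red component is captured by intersecting `S` with the reserved vertices
  -- or with their complement.
  componentOrder-≤ : ∀ (P : Fin n → Set) es v S → All (Stable P) es → P v →
                     (∀ {i} → P i → i ∈ S) → componentOrder es v ≤ length S
  componentOrder-≤ P es v S stable Pv P⊆S = ≤-trans
    (p⊆q⇒∣p∣≤∣q∣ {p = component es v} {fromList S}
      λ {i} i∈ → ∈-fromList S (P⊆S (component-⊆ P es stable v Pv i i∈)))
    (∣fromList∣≤ S)

-- Isolated vertices

Σ-allFin-suc : ∀ n (f : Fin (suc n) → ℕ) →
               Σₗ (allFin (suc n)) f ≡ f zero + Σₗ (allFin n) (f ∘ suc)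
Σ-allFin-suc n f = cong (λ x → f zero + sum x)
  (trans (map-tabulate suc f) (sym (map-tabulate id (f ∘ suc))))

length-allFin : ∀ n → length (allFin n) ≡ n
length-allFin n = length-tabulate {n = n} id

Σ-pick : ∀ {n} (u : Fin n) (f : Fin n → ℕ) →
         Σₗ (allFin n) (λ v → ι ⌊ v ≟ u ⌋ * f v) ≡ f u
Σ-pick {suc n} zero f = trans (Σ-allFin-suc n _)
  (trans (cong₂ _+_ (*-identityˡ (f zero))
            (trans (Σ-const (allFin n) 0) (*-zeroʳ (length (allFin n)))))
         (+-identityʳ (f zero)))
Σ-pick {suc n} (suc u) f = trans (Σ-allFin-suc n (λ v → ι ⌊ v ≟ suc u ⌋ * f v))
  (trans (Σ-cong (allFin n) λ v → cong (λ b → ι b * f (suc v)) (suc-≟ v)) (Σ-pick u (f ∘ suc)))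
  where
  suc-≟ : ∀ v → ⌊ suc v ≟ suc u ⌋ ≡ ⌊ v ≟ u ⌋
  suc-≟ v with v ≟ u
  ... | yes _ = refl
  ... | no _  = refl

module _ {n : ℕ} where

  private
    V : List (Fin n)
    V = allFin n

  member : List (Fin n) → Fin n → Bool
  member S v = any (λ x → ⌊ v ≟ x ⌋) S

  count-nonmembers : ∀ x S → member S x ≡ false →
    Σₗ V (ι ∘ not ∘ member S) ≡ suc (Σₗ V (ι ∘ not ∘ member (x ∷ S)))
  count-nonmembers x S x∉S = begin
    Σₗ V (ι ∘ not ∘ member S)
      ≡⟨ Σ-cong V split ⟩
    Σₗ V (λ v → ι ⌊ v ≟ x ⌋ * ι (not (member S v)) + ι (not (member (x ∷ S) v)))
      ≡⟨ Σ-+ V _ _ ⟩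
    Σₗ V (λ v → ι ⌊ v ≟ x ⌋ * ι (not (member S v))) + Σₗ V (ι ∘ not ∘ member (x ∷ S))
      ≡⟨ cong (_+ Σₗ V (ι ∘ not ∘ member (x ∷ S)))
           (trans (Σ-pick x _) (cong (ι ∘ not) x∉S)) ⟩
    suc (Σₗ V (ι ∘ not ∘ member (x ∷ S))) ∎
    where
    open ≡-Reasoning
    split : ∀ v → ι (not (member S v)) ≡
      ι ⌊ v ≟ x ⌋ * ι (not (member S v)) + ι (not (member (x ∷ S) v))
    split v with v ≟ x
    ... | yes _ = sym (trans (+-identityʳ _) (*-identityˡ _))
    ... | no _  = refl

  avoids : List (Fin n) → Edge n → Bool
  avoids S (u , v) = not (member S u) ∧ not (member S v)

  Σ-edges : ∀ (f : Edge n → ℕ) → Σₗ (edgesList n) f ≡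
    Σₗ V (λ u → Σₗ V (λ v → ι (not ⌊ u ≟ v ⌋) * f (u , v)))
  Σ-edges f = trans (Σ-concatMap _ V f) (Σ-cong V λ u →
    trans (Σ-concatMap _ V f) (Σ-cong V (one u)))
    where
    one : ∀ u v → Σₗ (if ⌊ u ≟ v ⌋ then [] else (u , v) ∷ []) f ≡
                  ι (not ⌊ u ≟ v ⌋) * f (u , v)
    one u v with u ≟ v
    ... | yes _ = refl
    ... | no _  = refl

  -- Once `u` is chosen outside `S`, distinctness of `v` becomes avoidance of `u ∷ S`, which leaves
  -- one choice fewer.
  count-avoiding : ∀ S k c →
    Σₗ V (ι ∘ not ∘ member S) ≡ k → k ≡ suc c →
    Σₗ (edgesList n) (ι ∘ avoids S) ≡ k * c
  count-avoiding S k c eq k≡ = begin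
    Σₗ (edgesList n) (ι ∘ avoids S)
      ≡⟨ Σ-edges (ι ∘ avoids S) ⟩
    Σₗ V (λ u → Σₗ V (λ v → ι (not ⌊ u ≟ v ⌋) * ι (avoids S (u , v))))
      ≡⟨ Σ-cong V (λ u → trans (Σ-cong V (factor u)) (Σ-*ˡ V (ι (not (member S u))) _)) ⟩
    Σₗ V (λ u → ι (not (member S u)) * Σₗ V (ι ∘ not ∘ member (u ∷ S)))
      ≡⟨ Σ-cong V inner ⟩
    Σₗ V (λ u → ι (not (member S u)) * c)
      ≡⟨ trans (Σ-*ʳ V _ c) (cong (_* c) eq) ⟩
    k * c ∎
    where
    open ≡-Reasoning
    ≟-comm : ∀ (u v : Fin n) → ⌊ u ≟ v ⌋ ≡ ⌊ v ≟ u ⌋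
    ≟-comm u v with u ≟ v | v ≟ u
    ... | yes _   | yes _   = refl
    ... | no _    | no _    = refl
    ... | yes u≡v | no v≢u  = contradiction (sym u≡v) v≢u
    ... | no u≢v  | yes v≡u = contradiction (sym v≡u) u≢v

    booleans : ∀ a b d → ι (not a) * ι (not b ∧ not d) ≡ ι (not b) * ι (not (a ∨ d))
    booleans true  true  _     = refl
    booleans true  false _     = refl
    booleans false true  _     = refl
    booleans false false _     = refl

    factor : ∀ u v → ι (not ⌊ u ≟ v ⌋) * ι (avoids S (u , v)) ≡
                     ι (not (member S u)) * ι (not (member (u ∷ S) v))
    factor u v = trans (booleans ⌊ u ≟ v ⌋ (member S u) (member S v))
      (cong (λ b → ι (not (member S u)) * ι (not (b ∨ member S v))) (≟-comm u v))

    inner : ∀ u → ι (not (member S u)) * Σₗ V (ι ∘ not ∘ member (u ∷ S)) ≡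
                  ι (not (member S u)) * c
    inner u with member S u in eq′
    ... | true  = refl
    ... | false = cong (1 *_) (suc-injective
          (trans (sym (count-nonmembers u S eq′)) (trans eq k≡)))

  isolated : List (Edge n) → Fin n → Bool
  isolated es v = all (avoids (v ∷ [])) es

  #isolated : List (Edge n) → ℕ
  #isolated es = Σₗ V (ι ∘ isolated es)

  avoids-pair : ∀ u v e → avoids (u ∷ []) e ∧ avoids (v ∷ []) e ≡ avoids (u ∷ v ∷ []) e
  avoids-pair u v (a , b) = booleans ⌊ a ≟ u ⌋ ⌊ b ≟ u ⌋ ⌊ a ≟ v ⌋ ⌊ b ≟ v ⌋
    where
    booleans : ∀ p q r s →
      (not (p ∨ false) ∧ not (q ∨ false)) ∧ (not (r ∨ false) ∧ not (s ∨ false)) ≡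
      not (p ∨ r ∨ false) ∧ not (q ∨ s ∨ false)
    booleans true  _     _     _     = refl
    booleans false true  true  _     = refl
    booleans false true  false _     = refl
    booleans false false true  _     = refl
    booleans false false false true  = refl
    booleans false false false false = refl

  -- Joint isolation is again a condition on each letter separately, which makes the second moment
  -- accessible to `Seq-all`.
  isolated-pair : ∀ u v es → ι (isolated es u) * ι (isolated es v) ≡
                             ι (all (avoids (u ∷ v ∷ [])) es)
  isolated-pair u v []       = refl
  isolated-pair u v (e ∷ es) = begin
    ι (p ∧ P) * ι (q ∧ P′)        ≡⟨ cong₂ _*_ (ι-∧ p P) (ι-∧ q P′) ⟩
    (ι p * ι P) * (ι q * ι P′)    ≡⟨ [m*n]*[o*p]≡[m*o]*[n*p] (ι p) (ι P) (ι q) (ι P′) ⟩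
    (ι p * ι q) * (ι P * ι P′)    ≡⟨ cong₂ _*_ (trans (sym (ι-∧ p q)) (cong ι (avoids-pair u v e)))
                                               (isolated-pair u v es) ⟩
    ι (avoids (u ∷ v ∷ []) e) * ι (all (avoids (u ∷ v ∷ [])) es) ≡⟨ ι-∧ (avoids (u ∷ v ∷ []) e) _ ⟨
    ι (all (avoids (u ∷ v ∷ [])) (e ∷ es)) ∎
    where
    open ≡-Reasoning
    p = avoids (u ∷ []) e
    q = avoids (v ∷ []) e
    P = isolated es u
    P′ = isolated es v

-- The pointwise step of Chebyshev's inequality, `e² ≤ (u − x)²`, expanded so that no truncated
-- subtraction occurs.
square-gap : ∀ u x e → x + e ≤ u → 2 * (u * x) + e * e ≤ u * u + x * x
square-gap u x e le with f , refl ← m≤n⇒∃[o]m+o≡n le = begin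
  2 * ((x + e + f) * x) + e * e
    ≤⟨ m≤m+n _ (2 * (e * f) + f * f) ⟩
  2 * ((x + e + f) * x) + e * e + (2 * (e * f) + f * f)
    ≡⟨ identity x e f ⟩
  (x + e + f) * (x + e + f) + x * x ∎
  where
  open ≤-Reasoning
  identity : ∀ x e f → 2 * ((x + e + f) * x) + e * e + (2 * (e * f) + f * f) ≡
                       (x + e + f) * (x + e + f) + x * x
  identity = solve-∀

two-products : ∀ u x → 2 * (u * x) ≤ u * u + x * x
two-products u x with ≤-total x u
... | inj₁ x≤u = ≤-trans (m≤m+n _ 0)
                   (square-gap u x 0 (≤-trans (≤-reflexive (+-identityʳ x)) x≤u))
... | inj₂ u≤x = ≤-trans (≤-reflexive (cong (2 *_) (*-comm u x)))
  (≤-trans (m≤m+n _ 0)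
  (≤-trans (square-gap x u 0 (≤-trans (≤-reflexive (+-identityʳ u)) u≤x))
           (≤-reflexive (+-comm (x * x) (u * u)))))

-- Second moment method.  For two vertices the events of being isolated are
-- negatively correlated, so the variance of #isolated is at most its mean.
module FewIsolated (n p : ℕ) (n≡ : n ≡ 3 + p) where

  -- The numbers of letters that avoid one given vertex and two given vertices.
  a b : ℕ
  a = (2 + p) * (1 + p)
  b = (1 + p) * p

  private
    V : List (Fin n)
    V = allFin n

    L : List (Edge n)
    L = edgesList n

    members₀ : Σₗ V (ι ∘ not ∘ member []) ≡ n
    members₀ = trans (Σ-const V 1) (trans (*-identityʳ (length V)) (length-allFin n))

    members₁ : ∀ u → Σₗ V (ι ∘ not ∘ member (u ∷ [])) ≡ 2 + p
    members₁ u = suc-injective (trans (sym (count-nonmembers u [] refl)) (trans members₀ n≡))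

    members₂ : ∀ u v → u ≢ v → Σₗ V (ι ∘ not ∘ member (u ∷ v ∷ [])) ≡ 1 + p
    members₂ u v u≢v = suc-injective
      (trans (sym (count-nonmembers u (v ∷ []) u∉)) (members₁ v))
      where
      u∉ : member (v ∷ []) u ≡ false
      u∉ with u ≟ v
      ... | yes u≡v = contradiction u≡v u≢v
      ... | no _    = refl

  length-edgesList : length (edgesList n) ≡ n * (2 + p)
  length-edgesList = trans (sym (*-identityʳ (length L)))
    (trans (sym (Σ-const L 1)) (count-avoiding {n} [] n (2 + p) members₀ n≡))

  module _ (m : ℕ) where

    τ : ℕ
    τ = length L ^ m

    private
      count₁ : ∀ u → Seq L m (λ es → ι (isolated es u)) ≡ a ^ m
      count₁ u = trans (Seq-all L m (avoids (u ∷ [])))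
        (cong (_^ m) (count-avoiding (u ∷ []) (2 + p) (1 + p) (members₁ u) refl))

      count₂ : ∀ u v → Seq L m (λ es → ι (isolated es u) * ι (isolated es v)) ≤
                       ι ⌊ v ≟ u ⌋ * a ^ m + b ^ m
      count₂ u v with v ≟ u
      ... | yes _ = ≤-trans
        (Seq-mono L m λ es _ → ≤-trans (*-monoʳ-≤ (ι (isolated es u)) (ι≤1 (isolated es v)))
                                       (≤-reflexive (*-identityʳ _)))
        (≤-trans (≤-reflexive (trans (count₁ u) (sym (*-identityˡ _)))) (m≤m+n _ (b ^ m)))
      ... | no v≢u = ≤-reflexive (trans (Seq-cong L m (isolated-pair u v))
        (trans (Seq-all L m (avoids (u ∷ v ∷ [])))
        (cong (_^ m) (count-avoiding (u ∷ v ∷ []) (1 + p) p (members₂ u v (v≢u ∘ sym)) refl))))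

      first-moment : Seq L m #isolated ≡ n * a ^ m
      first-moment = trans (Seq-Σ L m V _) (trans (Σ-cong V count₁)
        (trans (Σ-const V _) (cong (_* a ^ m) (length-allFin n))))

      open ≤-Reasoning

      second-moment : Seq L m (λ es → #isolated es * #isolated es) ≤
                      n * (a ^ m + n * b ^ m)
      second-moment = begin
        Seq L m (λ es → #isolated es * #isolated es)
          ≡⟨ Seq-cong L m (λ es → trans (sym (Σ-*ʳ V _ (#isolated es)))
               (Σ-cong V λ u → sym (Σ-*ˡ V (ι (isolated es u)) _))) ⟩
        Seq L m (λ es → Σₗ V λ u → Σₗ V λ v → ι (isolated es u) * ι (isolated es v))
          ≡⟨ trans (Seq-Σ L m V _) (Σ-cong V λ u → Seq-Σ L m V _) ⟩
        Σₗ V (λ u → Σₗ V λ v → Seq L m λ es → ι (isolated es u) * ι (isolated es v))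
          ≤⟨ Σ-mono V (λ u → Σ-mono V (count₂ u)) ⟩
        Σₗ V (λ u → Σₗ V λ v → ι ⌊ v ≟ u ⌋ * a ^ m + b ^ m)
          ≡⟨ Σ-cong V (λ u → trans (Σ-+ V _ _) (cong₂ _+_ (Σ-pick u _)
               (trans (Σ-const V _) (cong (_* b ^ m) (length-allFin n))))) ⟩
        Σₗ V (λ u → a ^ m + n * b ^ m)
          ≡⟨ trans (Σ-const V _) (cong (_* (a ^ m + n * b ^ m)) (length-allFin n)) ⟩
        n * (a ^ m + n * b ^ m) ∎

      -- Per letter the gap `a² − n(n−1)b` is exactly `2a`, because `(n−1)(n−2) = n(n−3) + 2`.
      negatively-correlated : τ * b ^ m ≤ a ^ m * a ^ m
      negatively-correlated = begin
        length L ^ m * b ^ m     ≡⟨ cong (λ x → x ^ m * b ^ m) length-edgesList ⟩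
        (n * (2 + p)) ^ m * b ^ m ≡⟨ ^-distribʳ-* m (n * (2 + p)) b ⟨
        (n * (2 + p) * b) ^ m    ≤⟨ ^-monoˡ-≤ m (subst (λ k → k * (2 + p) * b ≤ a * a) (sym n≡)
                                      (≤-trans (m≤m+n _ (2 * a)) (≤-reflexive (identity p)))) ⟩
        (a * a) ^ m              ≡⟨ ^-distribʳ-* m a a ⟩
        a ^ m * a ^ m ∎
        where
        identity : ∀ p → (3 + p) * (2 + p) * ((1 + p) * p) + 2 * ((2 + p) * (1 + p)) ≡
                   (2 + p) * (1 + p) * ((2 + p) * (1 + p))
        identity = solve-∀

      a^m≤τ : a ^ m ≤ τ
      a^m≤τ = ^-monoˡ-≤ m (≤-trans (*-mono-≤ (subst (2 + p ≤_) (sym n≡) (n≤1+n (2 + p))) (n≤1+n (1 + p)))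
                                   (≤-reflexive (sym length-edgesList)))

    -- Chebyshev's inequality scaled by `τ`: here `n * a ^ m` is `τ` times the mean number of
    -- isolated vertices. By negative correlation the squared mean cancels the off-diagonal part of
    -- the second moment, and the diagonal leaves `n * τ`.
    few-isolated : ∀ k d → (k + d) * τ ≤ n * a ^ m →
      Seq L m (λ es → ι (#isolated es <ᵇ k)) * (d * d) ≤ n * τ
    few-isolated k d mean = *-cancelʳ-≤ _ _ (τ * τ) {{>-nonZero ττ>0}}
      (+-cancelˡ-≤ (2 * (τ * (u * u))) _ _ (begin
      2 * (τ * (u * u)) + # * (d * d) * (τ * τ)
        ≡⟨ ring₁ τ (n * a ^ m) # d ⟩
      2 * (u * (n * a ^ m * τ)) + # * (d * τ * (d * τ))
        ≡⟨ cong (_+ # * (d * τ * (d * τ))) Σx ⟨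
      Seq L m (λ es → 2 * (u * x es)) + # * (d * τ * (d * τ))
        ≡⟨ trans (Seq-+ L m _ _) (cong (Seq L m (λ es → 2 * (u * x es)) +_) (Seq-*ʳ L m _ _)) ⟨
      Seq L m (λ es → 2 * (u * x es) + ι (#isolated es <ᵇ k) * (d * τ * (d * τ)))
        ≤⟨ Seq-mono L m (λ es _ → pointwise es) ⟩
      Seq L m (λ es → u * u + #isolated es * #isolated es * (τ * τ))
        ≡⟨ trans (Seq-+ L m _ _) (cong₂ _+_ (Seq-const L m (u * u)) (Seq-*ʳ L m _ (τ * τ))) ⟩
      τ * (u * u) + Seq L m (λ es → #isolated es * #isolated es) * (τ * τ)
        ≤⟨ +-monoʳ-≤ (τ * (u * u)) (*-monoˡ-≤ (τ * τ) second-moment) ⟩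
      τ * (u * u) + n * (a ^ m + n * b ^ m) * (τ * τ)
        ≡⟨ ring₂ τ (u * u) n (a ^ m) (b ^ m) ⟩
      τ * (u * u) + τ * (n * n * (τ * b ^ m)) + n * a ^ m * (τ * τ)
        ≤⟨ +-mono-≤ (+-monoʳ-≤ (τ * (u * u)) (*-monoʳ-≤ τ (*-monoʳ-≤ (n * n) negatively-correlated)))
                    (*-monoˡ-≤ (τ * τ) (*-monoʳ-≤ n a^m≤τ)) ⟩
      τ * (u * u) + τ * (n * n * (a ^ m * a ^ m)) + n * τ * (τ * τ)
        ≡⟨ ring₃ τ n (a ^ m) (n * τ * (τ * τ)) ⟩
      2 * (τ * (u * u)) + n * τ * (τ * τ) ∎))
      where
      u = n * a ^ m
      # = Seq L m (λ es → ι (#isolated es <ᵇ k))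
      x : List (Edge n) → ℕ
      x es = #isolated es * τ

      ττ>0 : 0 < τ * τ
      ττ>0 = *-mono-≤ τ>0 τ>0
        where
        τ>0 : 0 < τ
        τ>0 = subst (λ z → 0 < z ^ m) (sym length-edgesList)
          (subst (λ k → 0 < (k * (2 + p)) ^ m) (sym n≡) (m^n>0 ((3 + p) * (2 + p)) m))

      Σx : Seq L m (λ es → 2 * (u * x es)) ≡ 2 * (u * (n * a ^ m * τ))
      Σx = trans (Seq-*ˡ L m 2 _) (cong (2 *_) (trans (Seq-*ˡ L m u _)
        (cong (u *_) (trans (Seq-*ʳ L m _ τ) (cong (_* τ) first-moment)))))

      pointwise : ∀ es → 2 * (u * x es) + ι (#isolated es <ᵇ k) * (d * τ * (d * τ)) ≤
                         u * u + #isolated es * #isolated es * (τ * τ)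
      pointwise es with #isolated es <ᵇ k in eq
      ... | true = begin
        2 * (u * x es) + 1 * (d * τ * (d * τ))
          ≡⟨ cong (2 * (u * x es) +_) (*-identityˡ (d * τ * (d * τ))) ⟩
        2 * (u * x es) + d * τ * (d * τ)
          ≤⟨ square-gap u (x es) (d * τ) x+e≤u ⟩
        u * u + x es * x es
          ≡⟨ cong (u * u +_) ([m*n]*[o*p]≡[m*o]*[n*p] (#isolated es) τ (#isolated es) τ) ⟩
        u * u + #isolated es * #isolated es * (τ * τ) ∎
        where
        x+e≤u : x es + d * τ ≤ u
        x+e≤u = begin
          #isolated es * τ + d * τ ≡⟨ *-distribʳ-+ τ (#isolated es) d ⟨
          (#isolated es + d) * τ   ≤⟨ *-monoˡ-≤ τ (+-monoˡ-≤ d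
                                        (<⇒≤ (<ᵇ⇒< (#isolated es) k (subst T (sym eq) tt)))) ⟩
          (k + d) * τ              ≤⟨ mean ⟩
          u ∎
      ... | false = begin
        2 * (u * x es) + 0     ≡⟨ +-identityʳ _ ⟩
        2 * (u * x es)         ≤⟨ two-products u (x es) ⟩
        u * u + x es * x es
          ≡⟨ cong (u * u +_) ([m*n]*[o*p]≡[m*o]*[n*p] (#isolated es) τ (#isolated es) τ) ⟩
        u * u + #isolated es * #isolated es * (τ * τ) ∎

      ring₁ : ∀ τ u s d → 2 * (τ * (u * u)) + s * (d * d) * (τ * τ) ≡
                          2 * (u * (u * τ)) + s * (d * τ * (d * τ))
      ring₁ = solve-∀
      ring₂ : ∀ τ w n a b → τ * w + n * (a + n * b) * (τ * τ) ≡
                            τ * w + τ * (n * n * (τ * b)) + n * a * (τ * τ)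
      ring₂ = solve-∀
      ring₃ : ∀ τ n a z → τ * (n * a * (n * a)) + τ * (n * n * (a * a)) + z ≡
                          2 * (τ * (n * a * (n * a))) + z
      ring₃ = solve-∀

-- Selects exactly `k` vertices whenever that many satisfy `P`. The late drift conditions need an
-- upper bound on the reserved set as well as on its complement.
firstFew : ∀ {n} → ℕ → (Fin n → Bool) → Fin n → Bool
firstFew zero    P v       = false
firstFew (suc k) P zero    = P zero
firstFew (suc k) P (suc v) = firstFew (if P zero then k else suc k) (P ∘ suc) v

firstFew⇒ : ∀ {n} k (P : Fin n → Bool) v → firstFew k P v ≡ true → P v ≡ true
firstFew⇒ (suc k) P zero    eq = eq
firstFew⇒ (suc k) P (suc v) eq = firstFew⇒ (if P zero then k else suc k) (P ∘ suc) v eq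

count-firstFew-≤ : ∀ {n} k (P : Fin n → Bool) → Σₗ (allFin n) (ι ∘ firstFew k P) ≤ k
count-firstFew-≤ {n} zero P =
  ≤-reflexive (trans (Σ-const (allFin n) 0) (*-zeroʳ (length (allFin n))))
count-firstFew-≤ {zero}  (suc k) P = z≤n
count-firstFew-≤ {suc n} (suc k) P = subst (_≤ suc k) (sym (Σ-allFin-suc n _)) step
  where
  step : ι (P zero) + Σₗ (allFin n) (ι ∘ firstFew (if P zero then k else suc k) (P ∘ suc)) ≤ suc k
  step with P zero
  ... | true  = s≤s (count-firstFew-≤ k (P ∘ suc))
  ... | false = count-firstFew-≤ (suc k) (P ∘ suc)

count-firstFew-≥ : ∀ {n} k (P : Fin n → Bool) → k ≤ Σₗ (allFin n) (ι ∘ P) →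
                   k ≤ Σₗ (allFin n) (ι ∘ firstFew k P)
count-firstFew-≥ zero P le = z≤n
count-firstFew-≥ {suc n} (suc k) P le =
  subst (suc k ≤_) (sym (Σ-allFin-suc n _)) (step (subst (suc k ≤_) (Σ-allFin-suc n _) le))
  where
  step : suc k ≤ ι (P zero) + Σₗ (allFin n) (ι ∘ P ∘ suc) →
    suc k ≤ ι (P zero) + Σₗ (allFin n) (ι ∘ firstFew (if P zero then k else suc k) (P ∘ suc))
  step le with P zero
  step (s≤s le) | true = s≤s (count-firstFew-≥ k (P ∘ suc) le)
  step le | false = count-firstFew-≥ (suc k) (P ∘ suc) le

-- Rare survival of subcritical explorations

-- Bernoulli's inequality for `(1 − a/(b+a))^k`, cleared of denominators. The two variants after it
-- bound `(1 + a/b)^k` from above and from below.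
bernoulli : ∀ b a k → (b + a) ^ k * (b + a) ≤ b ^ k * (b + a) + k * a * (b + a) ^ k
bernoulli b a zero    = ≤-reflexive (sym (+-identityʳ _))
bernoulli b a (suc k) = begin
  (b + a) * X * (b + a)                            ≡⟨ *-assoc (b + a) X (b + a) ⟩
  (b + a) * (X * (b + a))                          ≤⟨ *-monoʳ-≤ (b + a) (bernoulli b a k) ⟩
  (b + a) * (b ^ k * (b + a) + k * a * X)          ≡⟨ identity₁ a b (b ^ k) k X ⟩
  b * b ^ k * (b + a) + a * (b ^ k * (b + a)) + k * a * ((b + a) * X)
    ≤⟨ +-monoˡ-≤ _ (+-monoʳ-≤ (b * b ^ k * (b + a)) (*-monoʳ-≤ a
         (*-monoˡ-≤ (b + a) (^-monoˡ-≤ k (m≤m+n b a))))) ⟩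
  b * b ^ k * (b + a) + a * (X * (b + a)) + k * a * ((b + a) * X)
    ≡⟨ identity₂ a b (b ^ k) k X ⟩
  b * b ^ k * (b + a) + suc k * a * ((b + a) * X) ∎
  where
  open ≤-Reasoning
  X = (b + a) ^ k
  identity₁ : ∀ a b c k x → (b + a) * (c * (b + a) + k * a * x) ≡
                            b * c * (b + a) + a * (c * (b + a)) + k * a * ((b + a) * x)
  identity₁ = solve-∀
  identity₂ : ∀ a b c k x → b * c * (b + a) + a * (x * (b + a)) + k * a * ((b + a) * x) ≡
                            b * c * (b + a) + (1 + k) * a * ((b + a) * x)
  identity₂ = solve-∀

bernoulli′ : ∀ b a k → (b + a) ^ k * b ≤ b ^ k * b + k * a * (b + a) ^ k
bernoulli′ b a k = +-cancelʳ-≤ (X * a) _ _ (begin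
  X * b + X * a                          ≡⟨ *-distribˡ-+ X b a ⟨
  X * (b + a)                            ≤⟨ bernoulli b a k ⟩
  b ^ k * (b + a) + k * a * X            ≡⟨ identity (b ^ k) b a (k * a * X) ⟩
  b ^ k * b + k * a * X + b ^ k * a      ≤⟨ +-monoʳ-≤ _ (*-monoˡ-≤ a (^-monoˡ-≤ k (m≤m+n b a))) ⟩
  b ^ k * b + k * a * X + X * a ∎)
  where
  open ≤-Reasoning
  X = (b + a) ^ k
  identity : ∀ c b a w → c * (b + a) + w ≡ c * b + w + c * a
  identity = solve-∀

bernoulli-lower : ∀ b a k → b ^ k * (b + k * a) ≤ (b + a) ^ k * b
bernoulli-lower b a zero    = ≤-reflexive (cong (1 *_) (+-identityʳ b))
bernoulli-lower b a (suc k) = begin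
  b * b ^ k * (b + suc k * a)                       ≤⟨ m≤m+n _ (k * a * a * b ^ k) ⟩
  b * b ^ k * (b + suc k * a) + k * a * a * b ^ k   ≡⟨ identity b a k (b ^ k) ⟩
  (b + a) * (b ^ k * (b + k * a))                   ≤⟨ *-monoʳ-≤ (b + a) (bernoulli-lower b a k) ⟩
  (b + a) * ((b + a) ^ k * b)                       ≡⟨ *-assoc (b + a) _ b ⟨
  (b + a) * (b + a) ^ k * b ∎
  where
  open ≤-Reasoning
  identity : ∀ b a k c → b * c * (b + (1 + k) * a) + k * a * a * c ≡
                         (b + a) * (c * (b + k * a))
  identity = solve-∀

-- Bernoulli gives `(1 + a/β)^k (1 − ka/β) ≤ 1`, so it suffices that `ma/β` is at most
-- `z/(Q + h + z)`, the relative drop from `Q + h + z` to `Q + h`. The excess weight thus splits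
-- into `z`, which pays for the neighbours, and `h`, which is the decay per step.
supersolution : ∀ Q h z a β k m → 0 < β → k ≤ m →
  (Q + (h + z)) * (m * a) ≤ z * β →
  (Q + h) * (β + a) ^ k ≤ (Q + (h + z)) * β ^ k
supersolution Q h z a β k m β>0 k≤m le =
  *-cancelʳ-≤ _ _ β {{>-nonZero β>0}} (+-cancelʳ-≤ (q * (k * a) * X) _ _ (begin
  (Q + h) * X * β + q * (k * a) * X
    ≤⟨ +-monoʳ-≤ ((Q + h) * X * β) (*-monoˡ-≤ X (≤-trans (*-monoʳ-≤ q (*-monoˡ-≤ a k≤m)) le)) ⟩
  (Q + h) * X * β + z * β * X
    ≡⟨ identity₁ Q h z X β ⟩
  q * (X * β)
    ≤⟨ *-monoʳ-≤ q (bernoulli′ β a k) ⟩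
  q * (β ^ k * β + k * a * X)
    ≡⟨ identity₂ q (β ^ k) β (k * a) X ⟩
  q * β ^ k * β + q * (k * a) * X ∎))
  where
  open ≤-Reasoning
  q = Q + (h + z)
  X = (β + a) ^ k
  identity₁ : ∀ Q h z x b → (Q + h) * x * b + z * b * x ≡ (Q + (h + z)) * (x * b)
  identity₁ = solve-∀
  identity₂ : ∀ q c b w x → q * (c * b + w * x) ≡ q * c * b + q * w * x
  identity₂ = solve-∀

n<2^[1+log₂n] : ∀ n → n < 2 ^ suc ⌊log₂ n ⌋
n<2^[1+log₂n] n = ≰⇒> λ le → 1+n≰n
  (≤-trans (≤-reflexive (sym (⌊log₂[2^n]⌋≡n (suc ⌊log₂ n ⌋)))) (⌊log₂⌋-mono-≤ le))

2^log₂n≤n : ∀ n → 0 < n → 2 ^ ⌊log₂ n ⌋ ≤ n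
2^log₂n≤n = <-rec _ step
  where
  step : ∀ n → (∀ {m} → m < n → 0 < m → 2 ^ ⌊log₂ m ⌋ ≤ m) → 0 < n → 2 ^ ⌊log₂ n ⌋ ≤ n
  step 1 _ _ = ≤-refl
  step n@(suc (suc k)) rec _ = begin
    2 ^ ⌊log₂ n ⌋              ≤⟨ ^-monoʳ-≤ 2 (m≤n+m∸n ⌊log₂ n ⌋ 1) ⟩
    2 * 2 ^ (⌊log₂ n ⌋ ∸ 1)    ≡⟨ cong (λ l → 2 * 2 ^ l) (⌊log₂⌊n/2⌋⌋≡⌊log₂n⌋∸1 n) ⟨
    2 * 2 ^ ⌊log₂ ⌊ n /2⌋ ⌋    ≤⟨ *-monoʳ-≤ 2 (rec (⌊n/2⌋<n (suc k)) (s≤s z≤n)) ⟩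
    2 * ⌊ n /2⌋                ≡⟨ cong (⌊ n /2⌋ +_) (+-identityʳ _) ⟩
    ⌊ n /2⌋ + ⌊ n /2⌋          ≤⟨ +-monoʳ-≤ ⌊ n /2⌋ (⌊n/2⌋≤⌈n/2⌉ n) ⟩
    ⌊ n /2⌋ + _                ≡⟨ ⌊n/2⌋+⌈n/2⌉≡n n ⟩
    n ∎
    where open ≤-Reasoning

-- The two sums belong to `w` as first and as second end; dropping the distinctness of the ends lets
-- each run over all vertices.
touching-sum : ∀ {n} (r : Edge n → Bool) w (g : Fin n → ℕ) →
  Σₗ (edgesList n) (λ e → ι (Exploration.touches r w e) * g (Exploration.otherEnd r w e)) ≤
  Σₗ (allFin n) (λ v → ι (r (w , v)) * g v) + Σₗ (allFin n) (λ u → ι (r (u , w)) * g u)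
touching-sum {n} r w g = begin
  Σₗ (edgesList n) (λ e → ι (touches w e) * g (otherEnd w e))
    ≡⟨ Σ-edges {n} _ ⟩
  Σₗ V (λ u → Σₗ V λ v → ι (not ⌊ u ≟ v ⌋) * (ι (touches w (u , v)) * g (otherEnd w (u , v))))
    ≤⟨ Σ-mono V (λ u → Σ-mono V λ v →
         ≤-trans (*-monoˡ-≤ _ (ι≤1 (not ⌊ u ≟ v ⌋))) (≤-trans (≤-reflexive (*-identityˡ _)) (one u v))) ⟩
  Σₗ V (λ u → Σₗ V λ v → ι ⌊ u ≟ w ⌋ * (ι (r (w , v)) * g v) + ι ⌊ v ≟ w ⌋ * (ι (r (u , w)) * g u))
    ≡⟨ Σ-cong V (λ u → trans (Σ-+ V _ _)
         (cong₂ _+_ (Σ-*ˡ V (ι ⌊ u ≟ w ⌋) _) (Σ-pick w (λ _ → ι (r (u , w)) * g u)))) ⟩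
  Σₗ V (λ u → ι ⌊ u ≟ w ⌋ * Σₗ V (λ v → ι (r (w , v)) * g v) + ι (r (u , w)) * g u)
    ≡⟨ trans (Σ-+ V _ _) (cong (_+ Σₗ V (λ u → ι (r (u , w)) * g u))
         (Σ-pick w (λ _ → Σₗ V (λ v → ι (r (w , v)) * g v)))) ⟩
  Σₗ V (λ v → ι (r (w , v)) * g v) + Σₗ V (λ u → ι (r (u , w)) * g u) ∎
  where
  open ≤-Reasoning
  open Exploration r
  V = allFin n

  one : ∀ u v → ι (touches w (u , v)) * g (otherEnd w (u , v)) ≤
    ι ⌊ u ≟ w ⌋ * (ι (r (w , v)) * g v) + ι ⌊ v ≟ w ⌋ * (ι (r (u , w)) * g u)
  one u v with u ≟ w | v ≟ w
  ... | yes refl | q with r (w , v)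
  ...   | true  = ≤-trans (≤-reflexive (sym (*-identityˡ _))) (m≤m+n _ _)
  ...   | false = z≤n
  one u v | no _ | yes refl with r (u , w)
  ...   | true  = ≤-reflexive (sym (*-identityˡ _))
  ...   | false = z≤n
  one u v | no _ | no _ with r (u , v)
  ...   | true  = z≤n
  ...   | false = z≤n

module RareSurvival (Q h C : ℕ) .{{_ : NonZero Q}} (C-large : 3 * Q ≤ C * h) where

  open ≤-Reasoning

  -- A factor 4 per `C` steps gives order `n²` over `C log₂ n` steps; after a union bound over `n`
  -- starting vertices a failure probability of order `1/n` is left.
  doubling : 4 * Q ^ C ≤ (Q + h) ^ C
  doubling = *-cancelʳ-≤ _ _ Q (begin
    4 * Q ^ C * Q          ≡⟨ identity (Q ^ C) Q ⟩
    Q ^ C * (Q + 3 * Q)    ≤⟨ *-monoʳ-≤ (Q ^ C) (+-monoʳ-≤ Q C-large) ⟩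
    Q ^ C * (Q + C * h)    ≤⟨ bernoulli-lower Q h C ⟩
    (Q + h) ^ C * Q ∎)
    where
    identity : ∀ c q → 4 * c * q ≡ c * (q + 3 * q)
    identity = solve-∀

  doubling-^ : ∀ l → 4 ^ l * Q ^ (C * l) ≤ (Q + h) ^ (C * l)
  doubling-^ l = begin
    4 ^ l * Q ^ (C * l)     ≡⟨ cong (4 ^ l *_) (^-*-assoc Q C l) ⟨
    4 ^ l * (Q ^ C) ^ l     ≡⟨ ^-distribʳ-* l 4 (Q ^ C) ⟨
    (4 * Q ^ C) ^ l         ≤⟨ ^-monoˡ-≤ l doubling ⟩
    ((Q + h) ^ C) ^ l       ≡⟨ ^-*-assoc (Q + h) C l ⟩
    (Q + h) ^ (C * l) ∎

  square≤4^ : ∀ n → n * n ≤ 4 * 4 ^ ⌊log₂ n ⌋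
  square≤4^ n = begin
    n * n                                      ≤⟨ *-mono-≤ lt lt ⟩
    2 ^ suc ⌊log₂ n ⌋ * 2 ^ suc ⌊log₂ n ⌋      ≡⟨ ^-distribˡ-+-* 2 (suc ⌊log₂ n ⌋) (suc ⌊log₂ n ⌋) ⟨
    2 ^ (suc ⌊log₂ n ⌋ + suc ⌊log₂ n ⌋)        ≡⟨ cong (λ x → 2 ^ (suc ⌊log₂ n ⌋ + x)) (+-identityʳ _) ⟨
    2 ^ (2 * suc ⌊log₂ n ⌋)                    ≡⟨ ^-*-assoc 2 2 (suc ⌊log₂ n ⌋) ⟨
    4 ^ suc ⌊log₂ n ⌋ ∎
    where
    lt : n ≤ 2 ^ suc ⌊log₂ n ⌋
    lt = <⇒≤ (n<2^[1+log₂n] n)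

  module _ {n : ℕ} (r : Edge n → Bool) (z Y : Fin n → ℕ) (m M₀ : ℕ)
    (n>0 : 0 < n) (M₀>0 : 0 < M₀)
    (y≤Q : ∀ w → h + z w ≤ Q)
    (drift : ∀ w → (Q + (h + z w)) * (m * Y w) ≤ z w * (Q * M₀))
    (room : M₀ + C * ⌊log₂ n ⌋ * (2 * n) ≤ length (edgesList n))
    (sumY : ∀ w → Σₗ (allFin n) (λ v → ι (r (w , v)) * (h + z v)) +
                  Σₗ (allFin n) (λ u → ι (r (u , w)) * (h + z u)) ≤ Y w)
    where

    open Exploration r

    private
      L = edgesList n
      V = allFin n
      l = ⌊log₂ n ⌋

      y : Fin n → ℕ
      y w = h + z w

      # : Fin n → ℕ
      # v = Seq L m (ι ∘ survives (C * l) (v ∷ []))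

      cond : ∀ w b k → M₀ ≤ b → k ≤ m →
        (Q + h) * (Q * b + Y w) ^ k ≤ (Q + y w) * (Q * b) ^ k
      cond w b k M₀≤b k≤m = supersolution Q h (z w) (Y w) (Q * b) k m
        (*-mono-≤ (>-nonZero⁻¹ Q) (≤-trans M₀>0 M₀≤b)) k≤m
        (≤-trans (drift w) (*-monoʳ-≤ (z w) (*-monoʳ-≤ Q M₀≤b)))

      degree : ∀ w → Σₗ L (ι ∘ touches w) ≤ 2 * n
      degree w = begin
        Σₗ L (ι ∘ touches w)
          ≡⟨ Σ-cong L (λ e → *-identityʳ _) ⟨
        Σₗ L (λ e → ι (touches w e) * 1)
          ≤⟨ touching-sum r w (const 1) ⟩
        Σₗ V (λ v → ι (r (w , v)) * 1) + Σₗ V (λ u → ι (r (u , w)) * 1)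
          ≤⟨ +-mono-≤ (Σ-mono V λ v → *-monoˡ-≤ 1 (ι≤1 (r (w , v))))
                      (Σ-mono V λ u → *-monoˡ-≤ 1 (ι≤1 (r (u , w)))) ⟩
        Σₗ V (λ v → 1) + Σₗ V (λ u → 1)
          ≡⟨ cong (λ x → x + x) (trans (Σ-const V 1) (trans (*-identityʳ (length V)) (length-allFin n))) ⟩
        n + n
          ≡⟨ cong (n +_) (+-identityʳ n) ⟨
        2 * n ∎

      -- The 8 is 4 · 2: rounding the logarithm down costs 4, and the weight of the starting vertex
      -- is at most 2 after division by `Q`.
      rare : ∀ v → # v * (n * n) ≤ 8 * length L ^ m
      rare v = *-cancelʳ-≤ _ _ (Q ^ (C * l) * (Q * 1))
        {{m*n≢0 (Q ^ (C * l)) (Q * 1) {{m^n≢0 Q (C * l)}} {{m*n≢0 Q 1}}}} (begin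
        # v * (n * n) * (Q ^ (C * l) * (Q * 1))
          ≤⟨ *-monoˡ-≤ _ (*-monoʳ-≤ (# v) (square≤4^ n)) ⟩
        # v * (4 * 4 ^ l) * (Q ^ (C * l) * (Q * 1))
          ≡⟨ ring₁ (# v) (4 ^ l) (Q ^ (C * l)) (Q * 1) ⟩
        4 * (# v * (4 ^ l * Q ^ (C * l) * (Q * 1)))
          ≤⟨ *-monoʳ-≤ 4 (*-monoʳ-≤ (# v) (*-monoˡ-≤ (Q * 1) (doubling-^ l))) ⟩
        4 * (# v * ((Q + h) ^ (C * l) * (Q * 1)))
          ≤⟨ *-monoʳ-≤ 4 (Subcritical.survives-bound Q h y Y (2 * n) M₀ m cond (C * l) (v ∷ []) L room
               (λ w → ≤-trans (touching-sum r w y) (sumY w)) degree m ≤-refl) ⟩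
        4 * (length L ^ m * (Q ^ (C * l) * ((Q + y v) * 1)))
          ≤⟨ *-monoʳ-≤ 4 (*-monoʳ-≤ (length L ^ m) (*-monoʳ-≤ (Q ^ (C * l))
               (*-monoˡ-≤ 1 (+-monoʳ-≤ Q (y≤Q v))))) ⟩
        4 * (length L ^ m * (Q ^ (C * l) * ((Q + Q) * 1)))
          ≡⟨ ring₂ (length L ^ m) (Q ^ (C * l)) Q ⟩
        8 * length L ^ m * (Q ^ (C * l) * (Q * 1)) ∎)
        where
        ring₁ : ∀ s f p q → s * (4 * f) * (p * q) ≡ 4 * (s * (f * p * q))
        ring₁ = solve-∀
        ring₂ : ∀ t p q → 4 * (t * (p * ((q + q) * 1))) ≡ 8 * t * (p * (q * 1))
        ring₂ = solve-∀

    rare-survival : Σₗ V (λ v → Seq L m (ι ∘ survives (C * l) (v ∷ []))) * n ≤ 8 * length L ^ m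
    rare-survival = *-cancelʳ-≤ _ _ n {{>-nonZero n>0}} (begin
      Σₗ V # * n * n              ≡⟨ *-assoc (Σₗ V #) n n ⟩
      Σₗ V # * (n * n)            ≡⟨ Σ-*ʳ V # (n * n) ⟨
      Σₗ V (λ v → # v * (n * n))  ≤⟨ Σ-mono V rare ⟩
      Σₗ V (λ v → 8 * length L ^ m) ≡⟨ trans (Σ-const V _) (cong (_* (8 * length L ^ m)) (length-allFin n)) ⟩
      n * (8 * length L ^ m)      ≡⟨ *-comm n _ ⟩
      8 * length L ^ m * n ∎)

-- The algorithm

module _ {n : ℕ} where

  colourFrom : OnlineAlg n → List (Edge n) → List (Edge n) → List (Edge n × Bool)
  colourFrom A hist []       = []
  colourFrom A hist (e ∷ es) = (e , A hist e) ∷ colourFrom A (hist ++ e ∷ []) es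

  -- The worker function of runAlg is not in scope; the with-abstraction turns
  -- its arguments into variables, which lets Agda solve the underscore by it.
  mutual
    runAlg-∷ : ∀ (A : OnlineAlg n) e es →
               runAlg A (e ∷ es) ≡ (e , A [] e) ∷ colourFrom A (e ∷ []) es
    runAlg-∷ A e es with e ∷ es | [ e ]
    ... | whole | hist = cong (_ ∷_) (worker≡colourFrom A whole hist es)

    worker≡colourFrom : ∀ (A : OnlineAlg n) (whole hist es : List (Edge n)) →
                        _ ≡ colourFrom A hist es
    worker≡colourFrom A whole hist []       = refl
    worker≡colourFrom A whole hist (e ∷ es) =
      cong (_ ∷_) (worker≡colourFrom A whole (hist ++ e ∷ []) es)

  runAlg≡colourFrom : ∀ (A : OnlineAlg n) es → runAlg A es ≡ colourFrom A [] es
  runAlg≡colourFrom A []       = refl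
  runAlg≡colourFrom A (e ∷ es) = runAlg-∷ A e es

  inside : (Fin n → Bool) → Edge n → Bool
  inside I (u , v) = I u ∧ I v

  reserved : ℕ → List (Edge n) → Fin n → Bool
  reserved k hist = firstFew k (isolated hist)

  -- `take m₁` recovers the first phase from any later history, so the reserved set does not change
  -- during the second phase.
  twoPhase : ℕ → ℕ → OnlineAlg n
  twoPhase m₁ k hist e =
    if length hist <ᵇ m₁ then true else inside (reserved k (take m₁ hist)) e

  take-length-++ : ∀ (es es′ : List (Edge n)) → take (length es) (es ++ es′) ≡ es
  take-length-++ []       es′ = refl
  take-length-++ (e ∷ es) es′ = cong (e ∷_) (take-length-++ es es′)

  isolated-∉ : ∀ {es : List (Edge n)} {u v} → (u , v) ∈ es → isolated es u ≢ true × isolated es v ≢ true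
  isolated-∉ {_ ∷ es} {u} {v} (here refl) = fst , snd
    where
    fst : isolated ((u , v) ∷ es) u ≢ true
    fst with u ≟ u
    ... | yes _  = λ ()
    ... | no u≢u = contradiction refl u≢u
    snd : isolated ((u , v) ∷ es) v ≢ true
    snd with u ≟ v | v ≟ v
    ... | yes _ | _      = λ ()
    ... | no _  | yes _  = λ ()
    ... | no _  | no v≢v = contradiction refl v≢v
  isolated-∉ {e ∷ es} {u} {v} (there e∈) = fst , snd
    where
    ∧-right : ∀ a {b} → a ∧ b ≡ true → b ≡ true
    ∧-right true eq = eq
    fst : isolated (e ∷ es) u ≢ true
    fst eq = proj₁ (isolated-∉ {es} {u} {v} e∈) (∧-right (avoids (u ∷ []) e) eq)
    snd : isolated (e ∷ es) v ≢ true
    snd eq = proj₂ (isolated-∉ {es} {u} {v} e∈) (∧-right (avoids (v ∷ []) e) eq)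

  module _ (k : ℕ) (es₁ : List (Edge n)) where

    private
      m₁ = length es₁
      A  = twoPhase m₁ k
      I  = reserved k es₁

    classEdges-late : ∀ c (P : Edge n → Set) hist es₂ →
      All (λ e → inside I e ≡ c → P e) es₂ →
      All P (classEdges c (colourFrom A (es₁ ++ hist) es₂))
    classEdges-late c P hist [] _ = []
    classEdges-late c P hist (e ∷ es₂) (p ∷ ps) = step (A (es₁ ++ hist) e) refl
      where
      colour : A (es₁ ++ hist) e ≡ inside I e
      colour with length (es₁ ++ hist) <ᵇ m₁ in eq
      ... | true  = contradiction
        (≤-trans (m≤m+n m₁ (length hist)) (≤-reflexive (sym (length-++ es₁))))
        (<⇒≱ (<ᵇ⇒< _ _ (subst T (sym eq) tt)))
      ... | false = cong (λ es → inside (reserved k es) e) (take-length-++ es₁ hist)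

      rest : All P (classEdges c (colourFrom A ((es₁ ++ hist) ++ e ∷ []) es₂))
      rest = subst (λ h → All P (classEdges c (colourFrom A h es₂)))
        (sym (++-assoc es₁ hist (e ∷ []))) (classEdges-late c P (hist ++ e ∷ []) es₂ ps)

      step : ∀ b → A (es₁ ++ hist) e ≡ b → All P (if ⌊ b Bool.≟ c ⌋
        then e ∷ classEdges c (colourFrom A ((es₁ ++ hist) ++ e ∷ []) es₂)
        else classEdges c (colourFrom A ((es₁ ++ hist) ++ e ∷ []) es₂))
      step b eq with b Bool.≟ c
      ... | yes b≡c = p (trans (sym colour) (trans eq b≡c)) ∷ rest
      ... | no _    = rest

    classEdges-early : ∀ c (P : Edge n → Set) hist es es₂ → hist ++ es ≡ es₁ →
      (c ≡ true → All P es) → All (λ e → inside I e ≡ c → P e) es₂ →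
      All P (classEdges c (colourFrom A hist (es ++ es₂)))
    classEdges-early c P hist [] es₂ eq _ ps =
      subst (λ h → All P (classEdges c (colourFrom A h es₂)))
        (trans (++-identityʳ es₁) (trans (sym eq) (++-identityʳ hist)))
        (classEdges-late c P [] es₂ ps)
    classEdges-early c P hist (e ∷ es) es₂ eq red ps = step (A hist e) refl
      where
      colour : A hist e ≡ true
      colour with length hist <ᵇ m₁ in eq′
      ... | true  = refl
      ... | false = ⊥-elim (subst T eq′ (<⇒<ᵇ hist<))
        where
        hist< : length hist < m₁
        hist< = ≤-trans (≤-trans (m≤m+n (suc (length hist)) (length es))
            (≤-reflexive (trans (sym (+-suc (length hist) (length es)))
                                (sym (length-++ hist)))))
          (≤-reflexive (cong length eq))

      rest : All P (classEdges c (colourFrom A (hist ++ e ∷ []) (es ++ es₂)))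
      rest = classEdges-early c P (hist ++ e ∷ []) es es₂ (trans (++-assoc hist (e ∷ []) es) eq)
        (λ c≡ → All.tail (red c≡)) ps

      step : ∀ b → A hist e ≡ b → All P (if ⌊ b Bool.≟ c ⌋
        then e ∷ classEdges c (colourFrom A (hist ++ e ∷ []) (es ++ es₂))
        else classEdges c (colourFrom A (hist ++ e ∷ []) (es ++ es₂)))
      step b eq with b Bool.≟ c
      ... | yes b≡c = All.head (red (trans (sym b≡c) (trans (sym eq) colour))) ∷ rest
      ... | no _    = rest

    classEdges-All : ∀ c (P : Edge n → Set) es₂ → (c ≡ true → All P es₁) →
      All (λ e → inside I e ≡ c → P e) es₂ →
      All P (classEdges c (runAlg A (es₁ ++ es₂)))
    classEdges-All c P es₂ red ps =
      subst (λ ces → All P (classEdges c ces)) (sym (runAlg≡colourFrom A (es₁ ++ es₂)))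
        (classEdges-early c P [] es₁ es₂ refl red ps)

    private
      reserved-∉ : ∀ {u v} → (u , v) ∈ es₁ → I u ≢ true × I v ≢ true
      reserved-∉ {u} {v} e∈ =
        (λ eq → proj₁ (isolated-∉ {es₁} {u} {v} e∈) (firstFew⇒ k (isolated es₁) u eq)) ,
        (λ eq → proj₂ (isolated-∉ {es₁} {u} {v} e∈) (firstFew⇒ k (isolated es₁) v eq))

      ∧-true : ∀ a {b} → a ∧ b ≡ true → a ≡ true × b ≡ true
      ∧-true true eq = refl , eq

      ≢true : ∀ {b} → b ≢ true → b ≡ false
      ≢true {true}  ne = contradiction refl ne
      ≢true {false} ne = refl

    open Exploration using (survives; extinct⇒closed)

    module _ (es₂ : List (Edge n)) (j : ℕ) (v : Fin n) where

      -- No red edge joins a reserved vertex to an unreserved one: first-phase edges miss the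
      -- reserved vertices, and later red edges lie inside them. So the side of `v` decides which
      -- single phase shapes its component, and the exploration of that phase bounds it.
      red-order : survives (const true) j (v ∷ []) es₁ ≡ false →
                  survives (inside I) j (v ∷ []) es₂ ≡ false →
                  componentOrder (classEdges true (runAlg A (es₁ ++ es₂))) v ≤ j
      red-order ext₁ ext₂ with I v in Iv
      ... | false with S , len , v∈S , closed ← extinct⇒closed (const true) j (v ∷ []) es₁ ext₁ =
        ≤-trans (componentOrder-≤ P _ v S
          (classEdges-All true (Stable P) es₂ (λ _ → All.tabulate first) (All.tabulate λ {e} _ → second e))
          (Iv , v∈S (here refl)) proj₂) len
        where
        P : Fin n → Set
        P i = I i ≡ false × i ∈ S
        first : ∀ {e} → e ∈ es₁ → Stable P e
        first e∈ with cl₁ , cl₂ ← All.lookup closed e∈ refl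
                    | ne₁ , ne₂ ← reserved-∉ e∈ =
          (λ (_ , u∈) → ≢true ne₂ , cl₁ u∈) , (λ (_ , w∈) → ≢true ne₁ , cl₂ w∈)
        second : ∀ e → inside I e ≡ true → Stable P e
        second (u , w) ins with Iu , Iw ← ∧-true (I u) ins =
          (λ (Iu′ , _) → contradiction (trans (sym Iu) Iu′) λ ()) ,
          (λ (Iw′ , _) → contradiction (trans (sym Iw) Iw′) λ ())
      ... | true with S , len , v∈S , closed ← extinct⇒closed (inside I) j (v ∷ []) es₂ ext₂ =
        ≤-trans (componentOrder-≤ P _ v S
          (classEdges-All true (Stable P) es₂ (λ _ → All.tabulate first) (All.tabulate second))
          (Iv , v∈S (here refl)) proj₂) len
        where
        P : Fin n → Set
        P i = I i ≡ true × i ∈ S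
        first : ∀ {e} → e ∈ es₁ → Stable P e
        first e∈ with ne₁ , ne₂ ← reserved-∉ e∈ =
          (λ (Iu , _) → contradiction Iu ne₁) , (λ (Iw , _) → contradiction Iw ne₂)
        second : ∀ {e} → e ∈ es₂ → inside I e ≡ true → Stable P e
        second {u , w} e∈ ins with Iu , Iw ← ∧-true (I u) ins
                                 | cl₁ , cl₂ ← All.lookup closed e∈ ins =
          (λ (_ , u∈) → Iw , cl₁ u∈) , (λ (_ , w∈) → Iu , cl₂ w∈)

      blue-order : survives (not ∘ inside I) j (v ∷ []) es₂ ≡ false →
                   componentOrder (classEdges false (runAlg A (es₁ ++ es₂))) v ≤ j
      blue-order ext
        with S , len , v∈S , closed ← extinct⇒closed (not ∘ inside I) j (v ∷ []) es₂ ext =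
        ≤-trans (componentOrder-≤ (_∈ S) _ v S
          (classEdges-All false (Stable (_∈ S)) es₂ (λ ()) (All.tabulate second))
          (v∈S (here refl)) id) len
        where
        second : ∀ {e} → e ∈ es₂ → inside I e ≡ false → Stable (_∈ S) e
        second e∈ out = All.lookup closed e∈ (cong not out)

    module _ (C : ℕ) (es₂ : List (Edge n)) where

      private
        V = allFin n
        j = C * ⌊log₂ n ⌋

        ι-large : ∀ x b → (b ≡ false → x ≤ j) → ι (not (x ≤ᵇ j)) ≤ ι b
        ι-large x true  _ = ι≤1 _
        ι-large x false f with x ≤ᵇ j in eq
        ... | true  = z≤n
        ... | false = ⊥-elim (subst T eq (≤⇒≤ᵇ (f refl)))

        ι-large₂ : ∀ x b c → (b ≡ false → c ≡ false → x ≤ j) →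
                   ι (not (x ≤ᵇ j)) ≤ ι b + ι c
        ι-large₂ x true  c _ = ≤-trans (ι≤1 _) (m≤m+n 1 (ι c))
        ι-large₂ x false c f = ι-large x c (f refl)

      bad-≤ : ι (not (good C A (es₁ ++ es₂))) ≤
        Σₗ V (λ v → ι (survives (const true) j (v ∷ []) es₁)) +
        (Σₗ V (λ v → ι (survives (inside I) j (v ∷ []) es₂)) +
         Σₗ V (λ v → ι (survives (not ∘ inside I) j (v ∷ []) es₂)))
      bad-≤ = begin
        ι (not (good C A (es₁ ++ es₂)))
          ≤⟨ ι-not-all (λ c → all (small c) V) (true ∷ false ∷ []) ⟩
        ι (not (all (small true) V)) + (ι (not (all (small false) V)) + 0)
          ≡⟨ cong (ι (not (all (small true) V)) +_) (+-identityʳ _) ⟩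
        ι (not (all (small true) V)) + ι (not (all (small false) V))
          ≤⟨ +-mono-≤ (ι-not-all (small true) V) (ι-not-all (small false) V) ⟩
        Σₗ V (ι ∘ not ∘ small true) + Σₗ V (ι ∘ not ∘ small false)
          ≤⟨ +-mono-≤ (Σ-mono V λ v → ι-large₂ _ _ _ (red-order es₂ j v))
                      (Σ-mono V λ v → ι-large _ _ (blue-order es₂ j v)) ⟩
        Σₗ V (λ v → ι (s₁ v) + ι (s₂ v)) + Σₗ V (ι ∘ s₃)
          ≡⟨ trans (cong (_+ Σₗ V (ι ∘ s₃)) (Σ-+ V _ _)) (+-assoc (Σₗ V (ι ∘ s₁)) _ _) ⟩
        Σₗ V (ι ∘ s₁) + (Σₗ V (ι ∘ s₂) + Σₗ V (ι ∘ s₃)) ∎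
        where
        open ≤-Reasoning
        small : Bool → Fin n → Bool
        small c v = componentOrder (classEdges c (runAlg A (es₁ ++ es₂))) v ≤ᵇ j
        s₁ s₂ s₃ : Fin n → Bool
        s₁ v = survives (const true) j (v ∷ []) es₁
        s₂ v = survives (inside I) j (v ∷ []) es₂
        s₃ v = survives (not ∘ inside I) j (v ∷ []) es₂

-- z + h is the weight of a vertex in the red process and of an unreserved
-- vertex in the blue one; z′ + h is that of a reserved vertex in the blue one.
module Failure
  (Q h C : ℕ) .{{_ : NonZero Q}} (C-large : 3 * Q ≤ C * h)
  (n p : ℕ) (n≡ : n ≡ 3 + p) (m₁ m₂ k J M₀ z z′ : ℕ)
  (y≤Q : h + z ≤ Q) (y′≤Q : h + z′ ≤ Q) (M₀>0 : 0 < M₀)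
  (room : M₀ + C * ⌊log₂ n ⌋ * (2 * n) ≤ n * (2 + p))
  (n≤k+J : n ≤ k + J)
  (drift-early : (Q + (h + z)) * (m₁ * (n * (h + z) + n * (h + z))) ≤ z * (Q * M₀))
  (drift-red : (Q + (h + z)) * (m₂ * (k * (h + z) + k * (h + z))) ≤ z * (Q * M₀))
  (drift-reserved : (Q + (h + z′)) * (m₂ * (J * (h + z) + J * (h + z))) ≤ z′ * (Q * M₀))
  (drift-other : (Q + (h + z)) *
    (m₂ * ((k * (h + z′) + J * (h + z)) + (k * (h + z′) + J * (h + z)))) ≤ z * (Q * M₀))
  where

  open Exploration using (survives)
  open RareSurvival Q h C C-large using (rare-survival)
  open ≤-Reasoning

  private
    L : List (Edge n)
    L = edgesList n

    V : List (Fin n)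
    V = allFin n

    T₁ T₂ : ℕ
    T₁ = length L ^ m₁
    T₂ = length L ^ m₂

    l = ⌊log₂ n ⌋

    n>0 : 0 < n
    n>0 = subst (0 <_) (sym n≡) (s≤s z≤n)

    room′ : M₀ + C * l * (2 * n) ≤ length L
    room′ = ≤-trans room (≤-reflexive (sym (FewIsolated.length-edgesList n p n≡)))

    S₁ : List (Edge n) → ℕ
    S₁ es₁ = Σₗ V (λ v → ι (survives (const true) (C * l) (v ∷ []) es₁))

    few : List (Edge n) → Bool
    few es₁ = #isolated es₁ <ᵇ k

    early : Seq L m₁ S₁ * n ≤ 8 * T₁
    early = ≤-trans (≤-reflexive (cong (_* n) (Seq-Σ L m₁ V _)))
      (rare-survival (const true) (const z) (const (n * (h + z) + n * (h + z))) m₁ M₀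
        n>0 M₀>0 (const y≤Q) (const drift-early) room′ (const (≤-reflexive (cong (λ x → x + x) sum-all))))
      where
      sum-all : Σₗ V (λ _ → ι true * (h + z)) ≡ n * (h + z)
      sum-all = trans (Σ-const V (1 * (h + z)))
        (cong₂ _*_ (length-allFin n) (*-identityˡ (h + z)))

    module Late (I : Fin n → Bool) (#I≤ : Σₗ V (ι ∘ I) ≤ k) (#I≥ : k ≤ Σₗ V (ι ∘ I)) where

      ∁-size : Σₗ V (ι ∘ not ∘ I) ≤ J
      ∁-size = +-cancelˡ-≤ (Σₗ V (ι ∘ I)) _ _ (begin
        Σₗ V (ι ∘ I) + Σₗ V (ι ∘ not ∘ I)    ≡⟨ Σ-+ V _ _ ⟨
        Σₗ V (λ v → ι (I v) + ι (not (I v))) ≡⟨ Σ-cong V (λ v → one (I v)) ⟩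
        Σₗ V (const 1)                       ≡⟨ trans (Σ-const V 1) (trans (*-identityʳ (length V)) (length-allFin n)) ⟩
        n                                    ≤⟨ n≤k+J ⟩
        k + J                                ≤⟨ +-monoˡ-≤ J #I≥ ⟩
        Σₗ V (ι ∘ I) + J ∎)
        where
        one : ∀ b → ι b + ι (not b) ≡ 1
        one true  = refl
        one false = refl

      red : Σₗ V (λ v → Seq L m₂ (λ es → ι (survives (inside I) (C * l) (v ∷ []) es))) * n ≤ 8 * T₂
      red = rare-survival (inside I) (const z) (const (k * (h + z) + k * (h + z))) m₂ M₀
        n>0 M₀>0 (const y≤Q) (const drift-red) room′
        (λ w → +-mono-≤ (bound (λ v → ∧≤ʳ (I w) (I v))) (bound (λ u → ∧≤ˡ (I u) (I w))))
        where
        ∧≤ʳ : ∀ a b → ι (a ∧ b) ≤ ι b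
        ∧≤ʳ true  b = ≤-refl
        ∧≤ʳ false b = z≤n
        ∧≤ˡ : ∀ a b → ι (a ∧ b) ≤ ι a
        ∧≤ˡ true  b = ι≤1 b
        ∧≤ˡ false b = z≤n
        bound : ∀ {P : Fin n → Bool} → (∀ v → ι (P v) ≤ ι (I v)) →
                Σₗ V (λ v → ι (P v) * (h + z)) ≤ k * (h + z)
        bound P≤ = ≤-trans (≤-reflexive (Σ-*ʳ V _ (h + z)))
          (*-monoˡ-≤ (h + z) (≤-trans (Σ-mono V P≤) #I≤))

      ζ : Bool → ℕ
      ζ b = if b then z′ else z

      -- Reserved vertices have no blue edges among themselves, hence only the `J` terms in their
      -- case. Everything is doubled because letters are ordered pairs.
      Yᵇ : Bool → ℕ
      Yᵇ true  = J * (h + z) + J * (h + z)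
      Yᵇ false = (k * (h + z′) + J * (h + z)) + (k * (h + z′) + J * (h + z))

      blue : Σₗ V (λ v → Seq L m₂ (λ es → ι (survives (not ∘ inside I) (C * l) (v ∷ []) es))) * n ≤ 8 * T₂
      blue = rare-survival (not ∘ inside I) (ζ ∘ I) (Yᵇ ∘ I) m₂ M₀
        n>0 M₀>0 (λ w → y≤ (I w)) (λ w → drift (I w)) room′
        (λ w → ≤-trans (+-mono-≤ (Σ-mono V λ v → term (I w) (I v))
          (≤-trans (Σ-mono V λ u → ≤-reflexive (cong (λ b → ι (not b) * (h + ζ (I u))) (∧-comm (I u) (I w))))
                   (Σ-mono V λ u → term (I w) (I u)))) (total (I w)))
        where
        y≤ : ∀ b → h + ζ b ≤ Q
        y≤ true  = y′≤Q
        y≤ false = y≤Q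
        drift : ∀ b → (Q + (h + ζ b)) * (m₂ * Yᵇ b) ≤ ζ b * (Q * M₀)
        drift true  = drift-reserved
        drift false = drift-other
        U : Bool → Bool → ℕ
        U true  b = ι (not b) * (h + z)
        U false b = ι b * (h + z′) + ι (not b) * (h + z)
        term : ∀ a b → ι (not (a ∧ b)) * (h + ζ b) ≤ U a b
        term true  true  = z≤n
        term true  false = ≤-refl
        term false true  = m≤m+n _ 0
        term false false = ≤-refl
        others : Σₗ V (λ v → ι (not (I v)) * (h + z)) ≤ J * (h + z)
        others = ≤-trans (≤-reflexive (Σ-*ʳ V _ (h + z))) (*-monoˡ-≤ (h + z) ∁-size)
        total : ∀ a → Σₗ V (λ v → U a (I v)) + Σₗ V (λ v → U a (I v)) ≤ Yᵇ a
        total true  = +-mono-≤ others others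
        total false = +-mono-≤ both both
          where
          both : Σₗ V (λ v → ι (I v) * (h + z′) + ι (not (I v)) * (h + z)) ≤ k * (h + z′) + J * (h + z)
          both = ≤-trans (≤-reflexive (Σ-+ V _ _)) (+-mono-≤
            (≤-trans (≤-reflexive (Σ-*ʳ V _ (h + z′))) (*-monoˡ-≤ (h + z′) #I≤)) others)

    bad : List (Edge n) → ℕ
    bad es = ι (not (good C (twoPhase m₁ k) es))

    -- With the first phase fixed, the reserved set is constant while the second phase is still a
    -- uniform word, so `Late` applies. If too few vertices are isolated, the trivial bound 1 is
    -- used.
    per-history : ∀ {M} → M ≤ n → ∀ es₁ → length es₁ ≡ m₁ →
      Seq L m₂ (λ es₂ → bad (es₁ ++ es₂)) * M ≤
      ι (few es₁) * (T₂ * M) + (S₁ es₁ * (T₂ * M) + 16 * T₂)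
    per-history {M} M≤n es₁ len with few es₁ in eq
    ... | true = begin
      Seq L m₂ (λ es₂ → bad (es₁ ++ es₂)) * M
        ≤⟨ *-monoˡ-≤ M (Seq-mono L m₂ λ es₂ _ → ι≤1 _) ⟩
      Seq L m₂ (const 1) * M     ≡⟨ cong (_* M) (trans (Seq-const L m₂ 1) (*-identityʳ T₂)) ⟩
      T₂ * M                     ≡⟨ *-identityˡ (T₂ * M) ⟨
      1 * (T₂ * M)               ≤⟨ m≤m+n _ _ ⟩
      1 * (T₂ * M) + (S₁ es₁ * (T₂ * M) + 16 * T₂) ∎
    ... | false = begin
      Seq L m₂ (λ es₂ → bad (es₁ ++ es₂)) * M
        ≤⟨ *-monoˡ-≤ M (Seq-mono L m₂ λ es₂ _ → bad-≤′ es₂) ⟩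
      Seq L m₂ (λ es₂ → S₁ es₁ + (R es₂ + B es₂)) * M
        ≡⟨ cong (_* M) (trans (Seq-+ L m₂ _ _) (cong₂ _+_ (Seq-const L m₂ (S₁ es₁))
             (trans (Seq-+ L m₂ _ _) (cong₂ _+_ (Seq-Σ L m₂ V _) (Seq-Σ L m₂ V _))))) ⟩
      (T₂ * S₁ es₁ + (ΣR + ΣB)) * M
        ≡⟨ ring₁ T₂ (S₁ es₁) ΣR ΣB M ⟩
      S₁ es₁ * (T₂ * M) + (ΣR * M + ΣB * M)
        ≤⟨ +-monoʳ-≤ (S₁ es₁ * (T₂ * M)) (+-mono-≤
             (≤-trans (*-monoʳ-≤ ΣR M≤n) red) (≤-trans (*-monoʳ-≤ ΣB M≤n) blue)) ⟩
      S₁ es₁ * (T₂ * M) + (8 * T₂ + 8 * T₂)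
        ≡⟨ cong (S₁ es₁ * (T₂ * M) +_) (*-distribʳ-+ T₂ 8 8) ⟨
      S₁ es₁ * (T₂ * M) + 16 * T₂ ∎
      where
      I : Fin n → Bool
      I = reserved k es₁

      open Late I (count-firstFew-≤ k (isolated es₁))
        (count-firstFew-≥ k (isolated es₁)
          (≮⇒≥ λ lt → subst T eq (<⇒<ᵇ lt)))

      R B : List (Edge n) → ℕ
      R es₂ = Σₗ V (λ v → ι (survives (inside I) (C * l) (v ∷ []) es₂))
      B es₂ = Σₗ V (λ v → ι (survives (not ∘ inside I) (C * l) (v ∷ []) es₂))

      ΣR ΣB : ℕ
      ΣR = Σₗ V (λ v → Seq L m₂ (λ es₂ → ι (survives (inside I) (C * l) (v ∷ []) es₂)))
      ΣB = Σₗ V (λ v → Seq L m₂ (λ es₂ → ι (survives (not ∘ inside I) (C * l) (v ∷ []) es₂)))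

      bad-≤′ : ∀ es₂ → bad (es₁ ++ es₂) ≤ S₁ es₁ + (R es₂ + B es₂)
      bad-≤′ es₂ = subst
        (λ m → ι (not (good C (twoPhase m k) (es₁ ++ es₂))) ≤ S₁ es₁ + (R es₂ + B es₂))
        len (bad-≤ k es₁ C es₂)

      ring₁ : ∀ t s r b m → (t * s + (r + b)) * m ≡ s * (t * m) + (r * m + b * m)
      ring₁ = solve-∀

  -- The 24 is 8 for the first phase and 8 each for the red and the blue explorations of the second;
  -- `c` accounts for too few isolated vertices.
  failure-bound : ∀ M c → M ≤ n →
    Seq L m₁ (λ es → ι (#isolated es <ᵇ k)) * M ≤ c * T₁ →
    Seq L (m₁ + m₂) bad * M ≤ (c + 24) * length L ^ (m₁ + m₂)
  failure-bound M c M≤n few≤ = begin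
    Seq L (m₁ + m₂) bad * M
      ≡⟨ trans (cong (_* M) (Seq-split L m₁ m₂ bad)) (sym (Seq-*ʳ L m₁ _ M)) ⟩
    Seq L m₁ (λ es₁ → Seq L m₂ (λ es₂ → bad (es₁ ++ es₂)) * M)
      ≤⟨ Seq-mono L m₁ (per-history M≤n) ⟩
    Seq L m₁ (λ es₁ → ι (few es₁) * (T₂ * M) + (S₁ es₁ * (T₂ * M) + 16 * T₂))
      ≡⟨ trans (Seq-+ L m₁ _ _) (cong₂ _+_ (Seq-*ʳ L m₁ _ (T₂ * M))
           (trans (Seq-+ L m₁ _ _) (cong₂ _+_ (Seq-*ʳ L m₁ S₁ (T₂ * M)) (Seq-const L m₁ (16 * T₂))))) ⟩
    F * (T₂ * M) + (Seq L m₁ S₁ * (T₂ * M) + T₁ * (16 * T₂))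
      ≡⟨ ring₁ F (Seq L m₁ S₁) T₁ T₂ M ⟩
    T₂ * (F * M) + (T₂ * (Seq L m₁ S₁ * M) + 16 * (T₁ * T₂))
      ≤⟨ +-mono-≤ (*-monoʳ-≤ T₂ few≤) (+-monoˡ-≤ (16 * (T₁ * T₂)) (*-monoʳ-≤ T₂
           (≤-trans (*-monoʳ-≤ (Seq L m₁ S₁) M≤n) early))) ⟩
    T₂ * (c * T₁) + (T₂ * (8 * T₁) + 16 * (T₁ * T₂))
      ≡⟨ ring₂ T₁ T₂ c ⟩
    (c + 24) * (T₁ * T₂)
      ≡⟨ cong ((c + 24) *_) (^-distribˡ-+-* (length L) m₁ m₂) ⟨
    (c + 24) * length L ^ (m₁ + m₂) ∎
    where
    F = Seq L m₁ (ι ∘ few)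
    ring₁ : ∀ f s t u m → f * (u * m) + (s * (u * m) + t * (16 * u)) ≡
                          u * (f * m) + (u * (s * m) + 16 * (t * u))
    ring₁ = solve-∀
    ring₂ : ∀ t u c → u * (c * t) + (u * (8 * t) + 16 * (t * u)) ≡ (c + 24) * (t * u)
    ring₂ = solve-∀

-- Numerical estimates

open ≤-Reasoning

suc-l-squared : ∀ l → suc l * suc l ≤ 4 * 2 ^ l
suc-l-squared l = ≤-trans (m≤m+n _ 2) (stronger l)
  where
  -- The surplus 2 makes the induction close: doubling then overshoots the next value by exactly
  -- `l * l`.
  stronger : ∀ l → suc l * suc l + 2 ≤ 4 * 2 ^ l
  stronger zero    = n≤1+n 3
  stronger (suc l) = begin
    suc (suc l) * suc (suc l) + 2                ≤⟨ m≤m+n _ (l * l) ⟩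
    suc (suc l) * suc (suc l) + 2 + l * l        ≡⟨ identity l ⟩
    2 * (suc l * suc l + 2)                      ≤⟨ *-monoʳ-≤ 2 (stronger l) ⟩
    2 * (4 * 2 ^ l)                              ≡⟨ commute (2 ^ l) ⟩
    4 * (2 * 2 ^ l) ∎
    where
    identity : ∀ l → (2 + l) * (2 + l) + 2 + l * l ≡ 2 * ((1 + l) * (1 + l) + 2)
    identity = solve-∀
    commute : ∀ x → 2 * (4 * x) ≡ 4 * (2 * x)
    commute = solve-∀

log₂-small : ∀ a n → 0 < n → 4 * (a * a) ≤ n → a * suc ⌊log₂ n ⌋ ≤ n
log₂-small a n n>0 large = ≮⇒≥ λ lt → <-irrefl refl (begin-strict
  n * n                  <⟨ *-mono-< lt lt ⟩
  a * s * (a * s)        ≡⟨ [m*n]*[o*p]≡[m*o]*[n*p] a s a s ⟩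
  a * a * (s * s)        ≤⟨ *-monoʳ-≤ (a * a) (≤-trans (suc-l-squared ⌊log₂ n ⌋)
                              (*-monoʳ-≤ 4 (2^log₂n≤n n n>0))) ⟩
  a * a * (4 * n)        ≡⟨ identity (a * a) n ⟩
  4 * (a * a) * n        ≤⟨ *-monoˡ-≤ n large ⟩
  n * n ∎)
  where
  s = suc ⌊log₂ n ⌋
  identity : ∀ b n → b * (4 * n) ≡ 4 * b * n
  identity = solve-∀

-- (1 − 2/n)^(tE) ≥ (a / (2 + a))^E, since (1 − 2/n)^t ≥ 1 − 2t/n.
isolation-probability : ∀ a E p t → t * 2 * (2 + a) ≤ 2 * (3 + p) →
  a ^ E * (3 + p) ^ (t * E) ≤ (2 + a) ^ E * (1 + p) ^ (t * E)
isolation-probability a E p t le = begin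
  a ^ E * n ^ (t * E)               ≡⟨ cong (a ^ E *_) (^-*-assoc n t E) ⟨
  a ^ E * (n ^ t) ^ E               ≡⟨ ^-distribʳ-* E a (n ^ t) ⟨
  (a * n ^ t) ^ E                   ≤⟨ ^-monoˡ-≤ E single ⟩
  ((2 + a) * (1 + p) ^ t) ^ E       ≡⟨ ^-distribʳ-* E (2 + a) ((1 + p) ^ t) ⟩
  (2 + a) ^ E * ((1 + p) ^ t) ^ E   ≡⟨ cong ((2 + a) ^ E *_) (^-*-assoc (1 + p) t E) ⟩
  (2 + a) ^ E * (1 + p) ^ (t * E) ∎
  where
  n = 3 + p
  single : a * n ^ t ≤ (2 + a) * (1 + p) ^ t
  single = *-cancelʳ-≤ _ _ n (+-cancelʳ-≤ (2 * n * n ^ t) _ _ (begin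
    a * n ^ t * n + 2 * n * n ^ t
      ≡⟨ identity₁ a (n ^ t) n ⟩
    (2 + a) * (n ^ t * n)
      ≤⟨ *-monoʳ-≤ (2 + a) (subst (λ m → m ^ t * m ≤ (1 + p) ^ t * m + t * 2 * m ^ t)
           (+-comm (1 + p) 2) (bernoulli (1 + p) 2 t)) ⟩
    (2 + a) * ((1 + p) ^ t * n + t * 2 * n ^ t)
      ≡⟨ identity₂ a ((1 + p) ^ t) n (t * 2) (n ^ t) ⟩
    (2 + a) * (1 + p) ^ t * n + t * 2 * (2 + a) * n ^ t
      ≤⟨ +-monoʳ-≤ ((2 + a) * (1 + p) ^ t * n) (*-monoˡ-≤ (n ^ t) le) ⟩
    (2 + a) * (1 + p) ^ t * n + 2 * n * n ^ t ∎))
    where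
    identity₁ : ∀ a x n → a * x * n + 2 * n * x ≡ (2 + a) * (x * n)
    identity₁ = solve-∀
    identity₂ : ∀ a y n s x → (2 + a) * (y * n + s * x) ≡ (2 + a) * y * n + s * (2 + a) * x
    identity₂ = solve-∀

-- A letter avoids a given vertex with probability `(n − 2)/n`, the factor `n − 1` cancelling. The
-- dependence on `n` is left to `isolation-probability`, so `κ * (2 + a) ^ E ≤ q * a ^ E` becomes a
-- closed inequality once numerals are put in.
mean-isolated : ∀ a E q κ p t M → t * 2 * (2 + a) ≤ 2 * (3 + p) →
  κ * (2 + a) ^ E ≤ q * a ^ E → q * M ≤ 3 + p →
  κ * M * ((3 + p) * (2 + p)) ^ (t * E) ≤ (3 + p) * ((2 + p) * (1 + p)) ^ (t * E)
mean-isolated a E q κ p t M le num qM≤n =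
  *-cancelʳ-≤ _ _ B {{m^n≢0 (2 + a) E}} (begin
  κ * M * (n * (2 + p)) ^ m * B
    ≡⟨ cong (λ x → κ * M * x * B) (^-distribʳ-* m n (2 + p)) ⟩
  κ * M * (n ^ m * P) * B
    ≡⟨ identity₁ κ M (n ^ m) P B ⟩
  κ * B * (M * (n ^ m * P))
    ≤⟨ *-monoˡ-≤ (M * (n ^ m * P)) num ⟩
  q * a ^ E * (M * (n ^ m * P))
    ≡⟨ identity₂ q (a ^ E) M (n ^ m) P ⟩
  q * M * (a ^ E * n ^ m * P)
    ≤⟨ *-mono-≤ qM≤n (*-monoˡ-≤ P (isolation-probability a E p t le)) ⟩
  n * (B * (1 + p) ^ m * P)
    ≡⟨ identity₃ n B ((1 + p) ^ m) P ⟩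
  n * (P * (1 + p) ^ m) * B
    ≡⟨ cong (λ x → n * x * B) (^-distribʳ-* m (2 + p) (1 + p)) ⟨
  n * ((2 + p) * (1 + p)) ^ m * B ∎)
  where
  n = 3 + p
  m = t * E
  B = (2 + a) ^ E
  P = (2 + p) ^ m
  identity₁ : ∀ k M x P B → k * M * (x * P) * B ≡ k * B * (M * (x * P))
  identity₁ = solve-∀
  identity₂ : ∀ q A M x P → q * A * (M * (x * P)) ≡ q * M * (A * x * P)
  identity₂ = solve-∀
  identity₃ : ∀ n B x P → n * (B * x * P) ≡ n * (P * x) * B
  identity₃ = solve-∀

-- Edge counts and neighbourhood weights are linear in `M`, so both sides carry `M²` and one
-- inequality between numerals serves all `n`.
drift-scale : ∀ a m Y z Q q g M {m′ Y′} → a * (m * Y) ≤ z * (Q * (q * g)) →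
  m′ ≤ m * M → Y′ ≤ Y * M → a * (m′ * Y′) ≤ z * (Q * (q * M * (g * M)))
drift-scale a m Y z Q q g M {m′} {Y′} num m≤ Y≤ = begin
  a * (m′ * Y′)                 ≤⟨ *-monoʳ-≤ a (*-mono-≤ m≤ Y≤) ⟩
  a * (m * M * (Y * M))         ≡⟨ identity₁ a m Y M ⟩
  a * (m * Y) * (M * M)         ≤⟨ *-monoˡ-≤ (M * M) num ⟩
  z * (Q * (q * g)) * (M * M)   ≡⟨ identity₂ z Q q g M ⟩
  z * (Q * (q * M * (g * M))) ∎
  where
  identity₁ : ∀ a m y M → a * (m * M * (y * M)) ≡ a * (m * y) * (M * M)
  identity₁ = solve-∀
  identity₂ : ∀ z Q q g M → z * (Q * (q * g)) * (M * M) ≡ z * (Q * (q * M * (g * M)))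
  identity₂ = solve-∀

-- Taking `g * M` in place of `suc g * M` in one factor frees `n * M` letters, enough for `c`
-- exploration steps that delete at most `2n` letters each.
room-left : ∀ g M p c → suc g * M ≤ 3 + p → 1 + 2 * c ≤ M →
  suc g * M * (g * M) + c * (2 * (3 + p)) ≤ (3 + p) * (2 + p)
room-left g M p c qM≤n small = begin
  suc g * M * (g * M) + c * (2 * n)   ≤⟨ +-monoˡ-≤ (c * (2 * n)) (*-monoˡ-≤ (g * M) qM≤n) ⟩
  n * (g * M) + c * (2 * n)           ≡⟨ identity₁ n (g * M) c ⟩
  n * (2 * c + g * M)                 ≤⟨ *-monoʳ-≤ n (+-cancelˡ-≤ 1 _ _
                                           (≤-trans (+-monoˡ-≤ (g * M) small) qM≤n)) ⟩
  n * (2 + p) ∎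
  where
  n = 3 + p
  identity₁ : ∀ n x c → n * x + c * (2 * n) ≡ n * (2 * c + x)
  identity₁ = solve-∀

double-scale : ∀ a M y {x} → x ≤ a * M → x * y + x * y ≤ (a * y + a * y) * M
double-scale a M y x≤ = ≤-trans (+-mono-≤ (*-monoˡ-≤ y x≤) (*-monoˡ-≤ y x≤))
  (≤-reflexive (identity a M y))
  where
  identity : ∀ a M y → a * M * y + a * M * y ≡ (a * y + a * y) * M
  identity = solve-∀

quotient-≥ : ∀ q .{{_ : NonZero q}} x n → q * x ≤ n → x ≤ n / q
quotient-≥ q x n le = begin
  x          ≡⟨ m*n/n≡m x q ⟨
  x * q / q  ≤⟨ /-monoˡ-≤ q (≤-trans (≤-reflexive (*-comm x q)) le) ⟩
  n / q ∎

-- The remainder is below `q`, and `q ≤ n / q` lets one further copy of the quotient absorb it.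
quotient-hi : ∀ q .{{_ : NonZero q}} n → q ≤ n / q → n ≤ suc q * (n / q)
quotient-hi q n q≤ = begin
  n                    ≡⟨ m≡m%n+[m/n]*n n q ⟩
  n % q + n / q * q    ≤⟨ +-mono-≤ (≤-trans (<⇒≤ (m%n<n n q)) q≤) (≤-reflexive (*-comm (n / q) q)) ⟩
  suc q * (n / q) ∎

log₂-absorbed : ∀ c q n M → 0 < n → n ≤ suc q * M →
  4 * (suc q * (1 + 2 * c) * (suc q * (1 + 2 * c))) ≤ n → 1 + 2 * (c * ⌊log₂ n ⌋) ≤ M
log₂-absorbed c q n M n>0 hi large = *-cancelˡ-≤ (suc q) (begin
  suc q * (1 + 2 * (c * l))          ≤⟨ *-monoʳ-≤ (suc q) (m≤m+n _ (l + 2 * c)) ⟩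
  suc q * (1 + 2 * (c * l) + (l + 2 * c)) ≡⟨ identity q c l ⟩
  suc q * (1 + 2 * c) * suc l        ≤⟨ log₂-small (suc q * (1 + 2 * c)) n n>0 large ⟩
  n                                  ≤⟨ hi ⟩
  suc q * M ∎)
  where
  l = ⌊log₂ n ⌋
  identity : ∀ q c l → (1 + q) * (1 + 2 * (c * l) + (l + 2 * c)) ≡ (1 + q) * (1 + 2 * c) * (1 + l)
  identity = solve-∀

-- Equals `3 * Q / h` for `Q = 10¹²` and `h = 1`, the least value that `C-large` allows.
C₀ : ℕ
C₀ = 3000000000000

-- The first phase consists of 10000 blocks of `t = 100 * M` rounds, the form `t * E` of
-- `isolation-probability`. The divisor is `2000100 = 100 * 20001`, so a vertex avoids all edges of
-- a block with probability at least `19999/20001`, whose power 10000 is almost exactly `1/e`.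
algorithm : (n : ℕ) → OnlineAlg n
algorithm n = twoPhase (100 * (n / 2000100) * 10000) (735750 * (n / 2000100))

-- With q = 2000100 and M = n / q the phases last 10⁶ M ≈ 0.499975 n and at most
-- 1120108 M ≈ 0.560026 n rounds.  Of the q M/e ≈ 735795 M isolated vertices,
-- 735750 M are reserved; the slack of 40 M below 735790 M feeds Chebyshev's
-- inequality.  With Q = 10¹² the weights are 1 + 10⁶/Q and, for reserved vertices
-- in the blue graph, 1 + 708100/Q, where 0.7081 slightly exceeds 2 · 0.56003 · (1 − 1/e).
-- Literals are kept in exactly the shape in which they are later compared, since
-- unfolding c * M for a large literal c takes c steps.
module Numerics (n p M : ℕ) (n≡ : n ≡ 3 + p) (M>0 : 0 < M)
  (lo : 2000100 * M ≤ n) (hi : n ≤ 2000101 * M)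
  (small : 1 + 2 * (C₀ * ⌊log₂ n ⌋) ≤ M) where

  m₁ m₂ k : ℕ
  m₁ = 100 * M * 10000
  m₂ = rounds n ∸ m₁
  k  = 735750 * M

  m₁≡ : m₁ ≡ 1000000 * M
  m₁≡ = trans (*-assoc 100 M 10000) (trans (cong (100 *_) (*-comm M 10000)) (trans (sym (*-assoc 100 10000 M))
    (cong (_* M) {100 * 10000} {1000000} refl)))

  M≤n : M ≤ n
  M≤n = ≤-trans (m≤m+n M (2000099 * M)) lo

  m₁≤rounds : m₁ ≤ rounds n
  m₁≤rounds = begin
    m₁                ≡⟨ m₁≡ ⟩
    1000000 * M       ≤⟨ *-monoˡ-≤ M (≤ᵇ⇒≤ 1000000 2000100 tt) ⟩
    2000100 * M       ≤⟨ lo ⟩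
    n                 ≡⟨ m*n/n≡m n 100 ⟨
    n * 100 / 100     ≡⟨ cong (_/ 100) (*-comm n 100) ⟩
    100 * n / 100     ≤⟨ /-monoˡ-≤ 100 (*-monoˡ-≤ n (≤ᵇ⇒≤ 100 106 tt)) ⟩
    106 * n / 100 ∎

  m₂≤ : m₂ ≤ 1120108 * M
  m₂≤ = m≤n+o⇒m∸n≤o (rounds n) m₁ (*-cancelʳ-≤ _ _ 100 (begin
    rounds n * 100                        ≤⟨ m/n*n≤m (106 * n) 100 ⟩
    106 * n                               ≤⟨ *-monoʳ-≤ 106 hi ⟩
    106 * (2000101 * M)                   ≡⟨ *-assoc 106 2000101 M ⟨
    -- `106 * 2000101 / 100` rounds up to 2120108, of which the first phase takes 1000000.
    106 * 2000101 * M                     ≤⟨ *-monoˡ-≤ M (≤ᵇ⇒≤ (106 * 2000101) (2120108 * 100) tt) ⟩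
    2120108 * 100 * M                     ≡⟨ *-assoc 2120108 100 M ⟩
    2120108 * (100 * M)                   ≡⟨ cong (2120108 *_) (*-comm 100 M) ⟩
    2120108 * (M * 100)                   ≡⟨ *-assoc 2120108 M 100 ⟨
    2120108 * M * 100                     ≡⟨ cong (_* 100) (trans (cong (_* M) {2120108} {1000000 + 1120108} refl)
                                                            (*-distribʳ-+ M 1000000 1120108)) ⟩
    (1000000 * M + 1120108 * M) * 100     ≡⟨ cong (λ x → (x + 1120108 * M) * 100) m₁≡ ⟨
    (m₁ + 1120108 * M) * 100 ∎))

  M₀ : ℕ
  M₀ = 2000100 * M * (2000099 * M)

  M₀>0 : 0 < M₀
  M₀>0 = *-mono-≤ (*-mono-≤ (≤ᵇ⇒≤ 1 2000100 tt) M>0) (*-mono-≤ (≤ᵇ⇒≤ 1 2000099 tt) M>0)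

  room : M₀ + C₀ * ⌊log₂ n ⌋ * (2 * n) ≤ n * (2 + p)
  room = subst (λ x → M₀ + C₀ * ⌊log₂ n ⌋ * (2 * x) ≤ x * (2 + p)) (sym n≡)
    (room-left 2000099 M p (C₀ * ⌊log₂ n ⌋) (subst (2000100 * M ≤_) n≡ lo) small)

  j : ℕ
  j = 1264351 * M

  n≤k+j : n ≤ k + j
  n≤k+j = ≤-trans hi (≤-reflexive (trans (cong (_* M) {2000101} {735750 + 1264351} refl)
                                         (*-distribʳ-+ M 735750 1264351)))

  drift-early : (1000000000000 + (1 + 999999)) * (m₁ * (n * (1 + 999999) + n * (1 + 999999))) ≤
                999999 * (1000000000000 * M₀)
  drift-early = drift-scale (1000000000000 + (1 + 999999)) 1000000
    (2000101 * (1 + 999999) + 2000101 * (1 + 999999)) 999999 1000000000000 2000100 2000099 M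
    (≤ᵇ⇒≤ _ _ tt) (≤-reflexive m₁≡) (double-scale 2000101 M (1 + 999999) hi)

  drift-red : (1000000000000 + (1 + 999999)) * (m₂ * (k * (1 + 999999) + k * (1 + 999999))) ≤
              999999 * (1000000000000 * M₀)
  drift-red = drift-scale (1000000000000 + (1 + 999999)) 1120108
    (735750 * (1 + 999999) + 735750 * (1 + 999999)) 999999 1000000000000 2000100 2000099 M
    (≤ᵇ⇒≤ _ _ tt) m₂≤ (double-scale 735750 M (1 + 999999) ≤-refl)

  drift-reserved : (1000000000000 + (1 + 708099)) * (m₂ * (j * (1 + 999999) + j * (1 + 999999))) ≤
                   708099 * (1000000000000 * M₀)
  drift-reserved = drift-scale (1000000000000 + (1 + 708099)) 1120108
    (1264351 * (1 + 999999) + 1264351 * (1 + 999999)) 708099 1000000000000 2000100 2000099 M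
    (≤ᵇ⇒≤ _ _ tt) m₂≤ (double-scale 1264351 M (1 + 999999) ≤-refl)

  drift-other : (1000000000000 + (1 + 999999)) *
    (m₂ * ((k * (1 + 708099) + j * (1 + 999999)) + (k * (1 + 708099) + j * (1 + 999999)))) ≤
    999999 * (1000000000000 * M₀)
  drift-other = drift-scale (1000000000000 + (1 + 999999)) 1120108
    ((735750 * (1 + 708099) + 735750 * (1 + 708099)) + (1264351 * (1 + 999999) + 1264351 * (1 + 999999)))
    999999 1000000000000 2000100 2000099 M (≤ᵇ⇒≤ _ _ tt) m₂≤ (begin
      (k * (1 + 708099) + j * (1 + 999999)) + (k * (1 + 708099) + j * (1 + 999999))
        ≡⟨ interchange (k * (1 + 708099)) (j * (1 + 999999)) (k * (1 + 708099)) (j * (1 + 999999)) ⟩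
      (k * (1 + 708099) + k * (1 + 708099)) + (j * (1 + 999999) + j * (1 + 999999))
        ≤⟨ +-mono-≤ (double-scale 735750 M (1 + 708099) ≤-refl) (double-scale 1264351 M (1 + 999999) ≤-refl) ⟩
      (735750 * (1 + 708099) + 735750 * (1 + 708099)) * M + (1264351 * (1 + 999999) + 1264351 * (1 + 999999)) * M
        ≡⟨ *-distribʳ-+ M (735750 * (1 + 708099) + 735750 * (1 + 708099)) (1264351 * (1 + 999999) + 1264351 * (1 + 999999)) ⟨
      ((735750 * (1 + 708099) + 735750 * (1 + 708099)) + (1264351 * (1 + 999999) + 1264351 * (1 + 999999))) * M ∎)

  expected-isolated : (k + 40 * M) * FewIsolated.τ n p n≡ m₁ ≤ n * FewIsolated.a n p n≡ ^ m₁
  expected-isolated = begin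
    (k + 40 * M) * length (edgesList n) ^ m₁
      ≡⟨ cong₂ (λ x y → x * y ^ m₁) k+d≡ (trans (FewIsolated.length-edgesList n p n≡) (cong (_* (2 + p)) n≡)) ⟩
    735790 * M * ((3 + p) * (2 + p)) ^ m₁
      ≤⟨ mean-isolated 19999 10000 2000100 735790 p (100 * M) M block-length
           (≤ᵇ⇒≤ _ _ tt) (subst (2000100 * M ≤_) n≡ lo) ⟩
    (3 + p) * ((2 + p) * (1 + p)) ^ m₁
      ≡⟨ cong (_* ((2 + p) * (1 + p)) ^ m₁) n≡ ⟨
    n * ((2 + p) * (1 + p)) ^ m₁ ∎
    where
    k+d≡ : k + 40 * M ≡ 735790 * M
    k+d≡ = trans (sym (*-distribʳ-+ M 735750 40)) (cong (_* M) {735750 + 40} {735790} refl)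

    reorder : ∀ a b c M → a * M * b * c ≡ a * b * c * M
    reorder = solve-∀

    block-length : 100 * M * 2 * (2 + 19999) ≤ 2 * (3 + p)
    block-length = begin
      100 * M * 2 * (2 + 19999)   ≡⟨ reorder 100 2 (2 + 19999) M ⟩
      100 * 2 * (2 + 19999) * M   ≡⟨ cong (_* M) {100 * 2 * (2 + 19999)} {2 * 2000100} refl ⟩
      2 * 2000100 * M             ≡⟨ *-assoc 2 2000100 M ⟩
      2 * (2000100 * M)           ≤⟨ *-monoʳ-≤ 2 (subst (2000100 * M ≤_) n≡ lo) ⟩
      2 * (3 + p) ∎

  few-bound : Seq (edgesList n) m₁ (λ es → ι (#isolated es <ᵇ k)) * M ≤
              1251 * length (edgesList n) ^ m₁
  few-bound = *-cancelʳ-≤ _ _ (1600 * M) {{>-nonZero (*-mono-≤ (≤ᵇ⇒≤ 1 1600 tt) M>0)}} (begin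
    # * M * (1600 * M)          ≡⟨ reorder # M ⟩
    # * (40 * M * (40 * M))     ≤⟨ FewIsolated.few-isolated n p n≡ m₁ k (40 * M) expected-isolated ⟩
    n * τ                       ≤⟨ *-monoˡ-≤ τ hi ⟩
    -- The slack `40 * M` squares to `1600 * (M * M)`, and 2000101 / 1600 lies just above 1250.
    2000101 * M * τ             ≤⟨ *-monoˡ-≤ τ (*-monoˡ-≤ M (≤ᵇ⇒≤ 2000101 (1251 * 1600) tt)) ⟩
    1251 * 1600 * M * τ         ≡⟨ reorder′ 1251 1600 M τ ⟩
    1251 * τ * (1600 * M) ∎)
    where
    # = Seq (edgesList n) m₁ (λ es → ι (#isolated es <ᵇ k))
    τ = length (edgesList n) ^ m₁
    reorder : ∀ s M → s * M * (1600 * M) ≡ s * (40 * M * (40 * M))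
    reorder = λ s M → trans (shuffle s M 1600) (trans (cong (λ c → s * (c * (M * M))) {1600} {40 * 40} refl)
                                                      (cong (s *_) (shuffle′ 40 M)))
      where
      shuffle : ∀ s M c → s * M * (c * M) ≡ s * (c * (M * M))
      shuffle = solve-∀
      shuffle′ : ∀ d M → d * d * (M * M) ≡ d * M * (d * M)
      shuffle′ = solve-∀
    reorder′ : ∀ a b M t → a * b * M * t ≡ a * t * (b * M)
    reorder′ = solve-∀

  rare-failure : badCount n C₀ (twoPhase m₁ k) * M ≤ 1275 * totalCount n
  rare-failure = begin
    badCount n C₀ (twoPhase m₁ k) * M
      ≡⟨ cong (_* M) (countSeq≡Seq (rounds n) _) ⟩
    Seq (edgesList n) (rounds n) bad * M
      ≡⟨ cong (λ m → Seq (edgesList n) m bad * M) (m+[n∸m]≡n m₁≤rounds) ⟨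
    Seq (edgesList n) (m₁ + m₂) bad * M
      ≤⟨ Failure.failure-bound 1000000000000 1 C₀ (≤ᵇ⇒≤ _ _ tt) n p n≡ m₁ m₂ k j M₀ 999999 708099
           (≤ᵇ⇒≤ _ _ tt) (≤ᵇ⇒≤ _ _ tt) M₀>0 room n≤k+j
           drift-early drift-red drift-reserved drift-other M 1251 M≤n few-bound ⟩
    (1251 + 24) * length (edgesList n) ^ (m₁ + m₂)
      ≡⟨ cong₂ (λ c m → c * length (edgesList n) ^ m) {1251 + 24} {1275} refl (m+[n∸m]≡n m₁≤rounds) ⟩
    1275 * length (edgesList n) ^ rounds n
      ≡⟨ cong (1275 *_) (trans (countSeq≡Seq {n} (rounds n) (const true))
           (trans (Seq-const (edgesList n) (rounds n) 1) (*-identityʳ (length (edgesList n) ^ rounds n)))) ⟨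
    1275 * totalCount n ∎
    where
    bad : List (Edge n) → ℕ
    bad es = ι (not (good C₀ (twoPhase m₁ k) es))

-- Failure probability of order 1/n

eventually-rare : ∀ n x → 2000100 * (2000100 + x) ≤ n →
  4 * (2000101 * (1 + 2 * C₀) * (2000101 * (1 + 2 * C₀))) ≤ n →
  badCount n C₀ (algorithm n) * x ≤ 1275 * totalCount n
eventually-rare n x n≥₁ n≥₂ = ≤-trans
  (*-monoʳ-≤ (badCount n C₀ (algorithm n)) (≤-trans (m≤n+m x 2000100) M≥))
  (Numerics.rare-failure n (n ∸ 3) (n / 2000100) n≡ M>0 lo hi
    (log₂-absorbed C₀ 2000100 n (n / 2000100) (≤-trans (≤ᵇ⇒≤ 1 2000100 tt) n≥2000100) hi n≥₂))
  where
  M≥ : 2000100 + x ≤ n / 2000100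
  M≥ = quotient-≥ 2000100 (2000100 + x) n n≥₁

  M≥2000100 : 2000100 ≤ n / 2000100
  M≥2000100 = ≤-trans (m≤m+n 2000100 x) M≥

  M>0 : 0 < n / 2000100
  M>0 = ≤-trans (≤ᵇ⇒≤ 1 2000100 tt) M≥2000100

  lo : 2000100 * (n / 2000100) ≤ n
  lo = ≤-trans (≤-reflexive (*-comm 2000100 (n / 2000100))) (m/n*n≤m n 2000100)

  hi : n ≤ 2000101 * (n / 2000100)
  hi = quotient-hi 2000100 n M≥2000100

  n≥2000100 : 2000100 ≤ n
  n≥2000100 = ≤-trans M≥2000100 (m/n≤m n 2000100)

  n≡ : n ≡ 3 + (n ∸ 3)
  n≡ = sym (m+[n∸m]≡n (≤-trans (≤ᵇ⇒≤ 3 2000100 tt) n≥2000100))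

divide-out : ∀ c .{{_ : NonZero c}} b s t → b * (c * s) ≤ c * t → b * s ≤ t
divide-out c b s t le = *-cancelˡ-≤ c (≤-trans (≤-reflexive (reorder c b s)) le)
  where
  reorder : ∀ c b s → c * (b * s) ≡ b * (c * s)
  reorder = solve-∀

eventually-both : ∀ {P : ℕ → Set} x y → (∀ n → x ≤ n → y ≤ n → P n) →
                  Σ ℕ λ N → ∀ n → n ≥ N → P n
eventually-both x y f = x + y , λ n n≥ → f n (m+n≤o⇒m≤o x n≥) (m+n≤o⇒n≤o x n≥)

theorem1p3 : Σ ℕ λ C → Σ ((n : ℕ) → OnlineAlg n) λ A →
    (k : ℕ) → Σ ℕ λ N → (n : ℕ) → n ≥ N →
    badCount n C (A n) * suc k ≤ totalCount n
theorem1p3 = C₀ , algorithm , λ k → eventually-both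
  -- From here on `n / 2000100` is at least `1275 * suc k`, which brings the failure probability
  -- below `1 / suc k`. The inner summand 2000100 keeps the quotient above the divisor, as
  -- `quotient-hi` requires; the second threshold absorbs the logarithm.
  (2000100 * (2000100 + 1275 * suc k))
  (4 * (2000101 * (1 + 2 * C₀) * (2000101 * (1 + 2 * C₀))))
  (λ n n≥₁ n≥₂ → divide-out 1275 (badCount n C₀ (algorithm n)) (suc k) (totalCount n)
    (eventually-rare n (1275 * suc k) n≥₁ n≥₂))
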